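{- Let $\mathcal{G}$ be a hypersequent provable in $\mathrm{G}^3\text{\L}\forall$, and let $\mathfrak{t}$ be a fair tactic. Then some $\mathrm{G}^3\text{\L}\forall$-proof of $\mathcal{G}$ can be constructed according to $\mathfrak{t}$.
   Context: Syntax. Fix a signature of predicate and function symbols of arbitrary nonnegative arities that includes a countable set of nullary function symbols called parameters (there are infinitely many of them). Terms are standard. Atomic $\mathrm{RPL}\forall$-formulas are $P(t_1,\dots,t_n)$ ($P$ a predicate symbol, $t_i$ terms) and truth constants $\bar r$ for rational $r\in[0,1]$. $\mathrm{RPL}\forall$-formulas are built from these using the logical symbols $\to$ (binary), $\forall$, $\exists$. $[A]^x_t$ is the result of substituting $t$ for all free occurrences of the variable $x$ in $A$. In addition there are countably (infinitely) many semipropositional variables of type 1, and countably (infinitely) many semipropositional variables of type 0. A formula is an $\mathrm{RPL}\forall$-formula or a semipropositional variable (so semipropositional variables do not occur inside compound formulas). An atom is an atomic $\mathrm{RPL}\forall$-formula or a semipropositional variable. A sequent $\Gamma\Rightarrow\Delta$ is an ordered pair of finite multisets of formulas (its members); it is atomic if all its members are atoms. A hypersequent $S_1\,|\,\cdots\,|\,S_n$ is a finite multiset of sequents. Semantics (needed for axioms). An hs-interpretation $M=\langle\mathcal{D},\mu\rangle$ has a nonempty domain $\mathcal{D}$; $\mu$ interprets $n$-ary function symbols by functions $\mathcal{D}^n\to\mathcal{D}$, $n$-ary predicate symbols by maps $\mathcal{D}^n\to[0,1]$, each semipropositional variable of type 0 by a real in $[0,+\infty)$, and each of type 1 by a real in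 $(-\infty,1]$. A valuation $\nu$ maps individual variables to $\mathcal{D}$. For atoms: $|\bar r|_{M,\nu}=r$; $|P(t_1,\dots,t_n)|_{M,\nu}=\mu(P)(|t_1|_{M,\nu},\dots,|t_n|_{M,\nu})$; a semipropositional variable has the value given by $\mu$. For a finite multiset $\Gamma$ of atoms, $|\Gamma|_{M,\nu}=\sum_{F\in\Gamma}(|F|_{M,\nu}-1)$ (with multiplicity; $0$ if $\Gamma$ is empty). An atomic sequent $\Gamma\Rightarrow\Delta$ is true under $M,\nu$ if $|\Delta|_{M,\nu}-|\Gamma|_{M,\nu}\geqslant0$. Calculus $\mathrm{G}^3\text{\L}\forall$. Axioms: all hypersequents in which, for every hs-interpretation $M$ and valuation $\nu$, there is an atomic sequent true under $M$ and $\nu$. Rules (premises / conclusion), with $A,B$ $\mathrm{RPL}\forall$-formulas, $\Gamma,\Delta$ finite multisets of formulas, $\mathcal{G}$ a (possibly empty) hypersequent: $(\to\Rightarrow)^3$: $\mathcal{G}\,|\,\Gamma,\mathfrak{p}\Rightarrow\Delta\,|\,B\Rightarrow\mathfrak{p},A$ / $\mathcal{G}\,|\,\Gamma,A\to B\Rightarrow\Delta$; $(\Rightarrow\to)^3$: $\mathcal{G}\,|\,\Gamma\Rightarrow\Delta$ and $\mathcal{G}\,|\,\Gamma,A\Rightarrow B,\Delta$ / $\mathcal{G}\,|\,\Gamma\Rightarrow A\to B,\Delta$; $(\forall\Rightarrow)^3$: $\mathcal{G}\,|\,\Gamma,\mathfrak{p}\Rightarrow\Delta\,|\,\forall xA\Rightarrow\mathfrak{p}\,|\,[A]^x_t\Rightarrow\mathfrak{p}$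 / $\mathcal{G}\,|\,\Gamma,\forall xA\Rightarrow\Delta$; $(\Rightarrow\forall)^3$: $\mathcal{G}\,|\,\Gamma\Rightarrow[A]^x_a,\Delta$ / $\mathcal{G}\,|\,\Gamma\Rightarrow\forall xA,\Delta$; $(\Rightarrow\exists)^3$: $\mathcal{G}\,|\,\Gamma\Rightarrow\mathfrak{q},\Delta\,|\,\mathfrak{q}\Rightarrow\exists xA\,|\,\mathfrak{q}\Rightarrow[A]^x_t$ / $\mathcal{G}\,|\,\Gamma\Rightarrow\exists xA,\Delta$; $(\exists\Rightarrow)^3$: $\mathcal{G}\,|\,\Gamma,[A]^x_a\Rightarrow\Delta$ / $\mathcal{G}\,|\,\Gamma,\exists xA\Rightarrow\Delta$. Here $\mathfrak{p}$ (type 1) and $\mathfrak{q}$ (type 0) are semipropositional variables not occurring in the conclusion, $t$ is a closed term, and $a$ is a parameter not occurring in the conclusion. Trees and tactics. A proof search tree for $\mathcal{H}$ is a finite tree of hypersequents with root $\mathcal{H}$ in which every non-leaf node together with its children is an application of a rule (node = conclusion, children = premises); a proof is a proof search tree all of whose leaves are axioms. A backward application of a rule extends a leaf that is the conclusion of a rule application by its premises. The principal formula occurrence of a rule application is the displayed occurrence in the conclusion of the formula containing the logical symbol named by the rule; a backward application to an occurrence is one with that occurrence principal. Ancestors: in a rule application, a nonprincipal formula occurrence in the conclusion has as immediate ancestor in each premise the corresponding copy of it there; the immediate ancestors of the principal occurrence are the formula occurrences displayed in the premises in the rule's formulation that replace it; "ancestor" is the reflexive-transitive closure. A tactic $\mathfrak{t}$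 is an algorithm that takes a proof search tree $D$ and returns either (a) a message indicating that no leaf hypersequent of $D$ contains any logical symbol, or (b) an occurrence $\mathfrak{t}(D)$ of a non-atomic $\mathrm{RPL}\forall$-formula, as a sequent member, in a leaf hypersequent of $D$. A result of a backward rule application to $D$ according to $\mathfrak{t}$ is $D$ itself if $\mathfrak{t}(D)$ is not a formula occurrence, and otherwise a proof search tree obtained from $D$ by a backward application of the (uniquely determined) rule to the occurrence $\mathfrak{t}(D)$ (with some admissible choice of the closed term, parameter, or semipropositional variable required by the rule). A proof search tree (in particular, a proof) for $\mathcal{H}$ can be constructed according to $\mathfrak{t}$ if it can be obtained from the one-node tree $\mathcal{H}$ by finitely many backward rule applications according to $\mathfrak{t}$. Let $\mathcal{D}^{\mathfrak{t}}_{\mathcal{H}}$ denote any (possibly infinite) tree obtained from $\mathcal{H}$ by an infinite sequence of backward rule applications according to $\mathfrak{t}$. The tactic $\mathfrak{t}$ is fair if for each hypersequent $\mathcal{H}$, each such tree $\mathcal{D}^{\mathfrak{t}}_{\mathcal{H}}$, each branch $\mathcal{B}$ of it, and each non-atomic $\mathrm{RPL}\forall$-formula occurrence $\mathcal{F}$ (as a sequent member) on $\mathcal{B}$, there is on $\mathcal{B}$ a backward application to some ancestor of $\mathcal{F}$. -}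

module Defs where

open import Data.List using (List; []; _∷_; [_]; _++_)
open import Data.List.Membership.Propositional using (_∈_; _∉_; _─_)
open import Data.List.Relation.Unary.All as All using (All; []; _∷_)
open import Data.List.Relation.Unary.Any using (Any; here; there)
open import Data.List.Relation.Unary.Any.Properties using (++⁻)
open import Data.Nat as ℕ using (ℕ; suc; _⊔_)
import Data.Nat.Properties as ℕ
open import Data.Product using (Σ; ∃-syntax; _×_; _,_)
open import Data.Rational as ℚ using (ℚ; 0ℚ; 1ℚ; ½)
import Data.Rational.Properties as ℚ
open import Data.Sum using (_⊎_; inj₁; inj₂)
open import Data.Vec using (Vec; []; _∷_)
import Data.Vec.Relation.Unary.All as Vec
import Data.Vec.Relation.Unary.Any as Vec
open import Function.Definitions using (Injective)
open import Relation.Binary.Construct.Closure.ReflexiveTransitive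
  using (Star; ε; _◅_; _◅◅_)
open import Relation.Binary.PropositionalEquality
  using (_≡_; refl; sym; trans; cong; subst)
open import Relation.Nullary using (¬_; yes; no)

------------------------------------------------------------------------
-- Real numbers: Cauchy sequences of rationals, with operations computed
-- termwise.  Only the ordered additive structure is needed.

module Real where

  record ℝ : Set where
    constructor real
    field
      seq    : ℕ → ℚ
      cauchy : ∀ δ → 0ℚ ℚ.< δ →
               ∃[ N ] ∀ m n → N ℕ.≤ m → N ℕ.≤ n → ℚ.∣ seq m ℚ.- seq n ∣ ℚ.≤ δ

  open ℝ

  fromℚ : ℚ → ℝ
  fromℚ q = real (λ _ → q) λ δ 0<δ → 0 , λ _ _ _ _ →
    subst (ℚ._≤ δ) (sym (cong ℚ.∣_∣ (ℚ.+-inverseʳ q))) (ℚ.<⇒≤ 0<δ)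

  0ℝ 1ℝ : ℝ
  0ℝ = fromℚ 0ℚ
  1ℝ = fromℚ 1ℚ

  private
    half-pos : ∀ {δ} → 0ℚ ℚ.< δ → 0ℚ ℚ.< ½ ℚ.* δ
    half-pos {δ} 0<δ =
      subst (ℚ._< ½ ℚ.* δ) (ℚ.*-zeroʳ ½) (ℚ.*-monoʳ-<-pos ½ 0<δ)

    half+half : ∀ δ → ½ ℚ.* δ ℚ.+ ½ ℚ.* δ ≡ δ
    half+half δ = trans (sym (ℚ.*-distribʳ-+ δ ½ ½)) (ℚ.*-identityˡ δ)

    interchange : ∀ a b c d →
      (a ℚ.+ b) ℚ.- (c ℚ.+ d) ≡ (a ℚ.- c) ℚ.+ (b ℚ.- d)
    interchange a b c d = trans
      (cong (a ℚ.+ b ℚ.+_) (ℚ.neg-distrib-+ c d))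
      (trans (ℚ.+-assoc a b _)
      (trans (cong (a ℚ.+_)
        (trans (sym (ℚ.+-assoc b (ℚ.- c) (ℚ.- d)))
        (trans (cong (ℚ._+ (ℚ.- d)) (ℚ.+-comm b (ℚ.- c)))
               (ℚ.+-assoc (ℚ.- c) b (ℚ.- d)))))
      (sym (ℚ.+-assoc a (ℚ.- c) _))))

  infixl 6 _+_ _-_
  infix  8 -_
  infix  4 _≤_

  _+_ : ℝ → ℝ → ℝ
  x + y = real (λ n → seq x n ℚ.+ seq y n) λ δ 0<δ →
    let N₁ , close₁ = cauchy x (½ ℚ.* δ) (half-pos 0<δ)
        N₂ , close₂ = cauchy y (½ ℚ.* δ) (half-pos 0<δ)
    in N₁ ⊔ N₂ , λ m n N≤m N≤n →
      subst (ℚ._≤ δ)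
        (sym (cong ℚ.∣_∣ (interchange (seq x m) (seq y m) (seq x n) (seq y n))))
        (ℚ.≤-trans
          (ℚ.∣p+q∣≤∣p∣+∣q∣ (seq x m ℚ.- seq x n) (seq y m ℚ.- seq y n))
          (ℚ.≤-trans
            (ℚ.+-mono-≤
              (close₁ m n (ℕ.m⊔n≤o⇒m≤o N₁ N₂ N≤m) (ℕ.m⊔n≤o⇒m≤o N₁ N₂ N≤n))
              (close₂ m n (ℕ.m⊔n≤o⇒n≤o N₁ N₂ N≤m) (ℕ.m⊔n≤o⇒n≤o N₁ N₂ N≤n)))
            (ℚ.≤-reflexive (half+half δ))))

  -_ : ℝ → ℝ
  - x = real (λ n → ℚ.- seq x n) λ δ 0<δ →
    let N , close = cauchy x δ 0<δ
    in N , λ m n N≤m N≤n →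
      subst (ℚ._≤ δ)
        (sym (trans
          (cong ℚ.∣_∣ (sym (ℚ.neg-distrib-+ (seq x m) (ℚ.- seq x n))))
          (ℚ.∣-p∣≡∣p∣ (seq x m ℚ.- seq x n))))
        (close m n N≤m N≤n)

  _-_ : ℝ → ℝ → ℝ
  x - y = x + (- y)

  _≤_ : ℝ → ℝ → Set
  x ≤ y = ∀ δ → 0ℚ ℚ.< δ →
          ∃[ N ] ∀ n → N ℕ.≤ n → seq x n ℚ.≤ seq y n ℚ.+ δ

open Real using (ℝ; 0ℝ; 1ℝ; fromℚ)

------------------------------------------------------------------------

record Signature : Set₁ where
  field
    Pred            : ℕ → Set   -- indexed by arity
    Func            : ℕ → Set   -- indexed by arity
    param           : ℕ → Func 0
    param-injective : Injective _≡_ _≡_ param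

module Calculus (sig : Signature) where

  open Signature sig

  ----------------------------------------------------------------------
  -- Syntax

  Var : Set
  Var = ℕ

  data Term : Set where
    var : Var → Term
    fn  : ∀ {n} → Func n → Vec Term n → Term

  infixr 6 _⊃_

  data RPL : Set where
    pred  : ∀ {n} → Pred n → Vec Term n → RPL
    const : (r : ℚ) → 0ℚ ℚ.≤ r → r ℚ.≤ 1ℚ → RPL
    _⊃_   : RPL → RPL → RPL
    all   : Var → RPL → RPL
    ex    : Var → RPL → RPL

  data Formula : Set where
    rpl   : RPL → Formula
    semi₁ : ℕ → Formula
    semi₀ : ℕ → Formula

  data Atom : Formula → Set where
    pred  : ∀ {n} {P : Pred n} {ts} → Atom (rpl (pred P ts))
    const : ∀ {r 0≤r r≤1} → Atom (rpl (const r 0≤r r≤1))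
    semi₁ : ∀ {i} → Atom (semi₁ i)
    semi₀ : ∀ {i} → Atom (semi₀ i)

  -- Lists stand for finite multisets: every notion below that refers to a
  -- member of a list allows it to be at any position.

  infix 4 _⇒_

  record Sequent : Set where
    constructor _⇒_
    field
      ante : List Formula
      succ : List Formula

  open Sequent public

  Hypersequent : Set
  Hypersequent = List Sequent

  data Closed : Term → Set where
    fn : ∀ {n} {f : Func n} {ts} → Vec.All Closed ts → Closed (fn f ts)

  mutual
    substTerm : Var → Term → Term → Term
    substTerm x t (var y) with x ℕ.≟ y
    ... | yes _ = t
    ... | no  _ = var y
    substTerm x t (fn f ts) = fn f (substTerms x t ts)

    substTerms : ∀ {n} → Var → Term → Vec Term n → Vec Term n
    substTerms x t []       = []
    substTerms x t (s ∷ ss) = substTerm x t s ∷ substTerms x t ss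

  -- No renaming of bound variables: the rules only substitute closed terms.
  infix 9 _[_/_]

  _[_/_] : RPL → Term → Var → RPL
  pred P ts       [ t / x ] = pred P (substTerms x t ts)
  const r 0≤r r≤1 [ t / x ] = const r 0≤r r≤1
  (A ⊃ B)         [ t / x ] = A [ t / x ] ⊃ B [ t / x ]
  all y A         [ t / x ] with x ℕ.≟ y
  ... | yes _ = all y A
  ... | no  _ = all y (A [ t / x ])
  ex y A          [ t / x ] with x ℕ.≟ y
  ... | yes _ = ex y A
  ... | no  _ = ex y (A [ t / x ])

  parameter : ℕ → Term
  parameter a = fn (param a) []

  data OccursInTerm (a : ℕ) : Term → Set where
    here : OccursInTerm a (parameter a)
    arg  : ∀ {n} {f : Func n} {ts} →
           Vec.Any (OccursInTerm a) ts → OccursInTerm a (fn f ts)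

  data OccursIn (a : ℕ) : RPL → Set where
    pred : ∀ {n} {P : Pred n} {ts} →
           Vec.Any (OccursInTerm a) ts → OccursIn a (pred P ts)
    ⊃ˡ   : ∀ {A B} → OccursIn a A → OccursIn a (A ⊃ B)
    ⊃ʳ   : ∀ {A B} → OccursIn a B → OccursIn a (A ⊃ B)
    all  : ∀ {x A} → OccursIn a A → OccursIn a (all x A)
    ex   : ∀ {x A} → OccursIn a A → OccursIn a (ex x A)

  AllMembers : (Formula → Set) → Sequent → Set
  AllMembers Q S = All Q (ante S) × All Q (succ S)

  FreshParam : ℕ → Hypersequent → Set
  FreshParam a = All (AllMembers λ F → ∀ {A} → F ≡ rpl A → ¬ OccursIn a A)

  FreshSemi : Formula → Hypersequent → Set
  FreshSemi p = All λ S → p ∉ ante S × p ∉ succ S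

  ----------------------------------------------------------------------
  -- Semantics

  record Interpretation : Set₁ where
    field
      Domain   : Set
      element  : Domain
      funcᴹ    : ∀ {n} → Func n → Vec Domain n → Domain
      predᴹ    : ∀ {n} → Pred n → Vec Domain n → ℝ
      0≤predᴹ  : ∀ {n} (P : Pred n) ds → 0ℝ Real.≤ predᴹ P ds
      predᴹ≤1  : ∀ {n} (P : Pred n) ds → predᴹ P ds Real.≤ 1ℝ
      semi₀ᴹ   : ℕ → ℝ
      0≤semi₀ᴹ : ∀ i → 0ℝ Real.≤ semi₀ᴹ i
      semi₁ᴹ   : ℕ → ℝ
      semi₁ᴹ≤1 : ∀ i → semi₁ᴹ i Real.≤ 1ℝ

  module _ (M : Interpretation) where

    open Interpretation M

    Valuation : Set
    Valuation = Var → Domain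

    module _ (ν : Valuation) where

      mutual
        termValue : Term → Domain
        termValue (var x)   = ν x
        termValue (fn f ts) = funcᴹ f (termValues ts)

        termValues : ∀ {n} → Vec Term n → Vec Domain n
        termValues []       = []
        termValues (t ∷ ts) = termValue t ∷ termValues ts

      value : ∀ {F} → Atom F → ℝ
      value (pred {P = P} {ts}) = predᴹ P (termValues ts)
      value (const {r})         = fromℚ r
      value (semi₁ {i})         = semi₁ᴹ i
      value (semi₀ {i})         = semi₀ᴹ i

      multisetValue : ∀ {Γ} → All Atom Γ → ℝ
      multisetValue []       = 0ℝ
      multisetValue (F ∷ Fs) = (value F Real.- 1ℝ) Real.+ multisetValue Fs

      TrueAtomic : Sequent → Set
      TrueAtomic (Γ ⇒ Δ) =
        Σ (All Atom Γ) λ atomsΓ → Σ (All Atom Δ) λ atomsΔ →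
        0ℝ Real.≤ multisetValue atomsΔ Real.- multisetValue atomsΓ

  Axiom : Hypersequent → Set₁
  Axiom H = ∀ (M : Interpretation) (ν : Valuation M) → Any (TrueAtomic M ν) H

  ----------------------------------------------------------------------
  -- Formula occurrences and rules

  data Side : Set where
    left right : Side

  members : Side → Sequent → List Formula
  members left  = ante
  members right = succ

  record Occurrence (H : Hypersequent) : Set where
    constructor occurrence
    field
      {sequent} : Sequent
      position  : sequent ∈ H
      side      : Side
      {formula} : Formula
      member    : formula ∈ members side sequent

  open Occurrence public

  -- What replaces the principal occurrence in one premise: members added to
  -- its own sequent on either side, and further sequents.
  record Replacement : Set where
    constructor ⟨_,_∣_⟩
    field
      addAnte : List Formula
      addSucc : List Formula
      extra   : List Sequent

  open Replacement public

  -- Rule H s F Rs: the rule for a principal occurrence of F on side s of a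
  -- sequent of the conclusion H, with one premise per entry of Rs.
  data Rule (H : Hypersequent) : Side → Formula → List Replacement → Set where

    →⇒ : ∀ {A B} p → FreshSemi (semi₁ p) H →
         Rule H left (rpl (A ⊃ B))
           [ ⟨ [ semi₁ p ] , [] ∣ [ [ rpl B ] ⇒ semi₁ p ∷ rpl A ∷ [] ] ⟩ ]

    ⇒→ : ∀ {A B} →
         Rule H right (rpl (A ⊃ B))
           ( ⟨ [] , [] ∣ [] ⟩
           ∷ ⟨ [ rpl A ] , [ rpl B ] ∣ [] ⟩
           ∷ [])

    ∀⇒ : ∀ {x A} p → FreshSemi (semi₁ p) H → ∀ t → Closed t →
         Rule H left (rpl (all x A))
           [ ⟨ [ semi₁ p ] , []
             ∣ ([ rpl (all x A) ] ⇒ [ semi₁ p ])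
             ∷ ([ rpl (A [ t / x ]) ] ⇒ [ semi₁ p ])
             ∷ [] ⟩ ]

    ⇒∀ : ∀ {x A} a → FreshParam a H →
         Rule H right (rpl (all x A))
           [ ⟨ [] , [ rpl (A [ parameter a / x ]) ] ∣ [] ⟩ ]

    ⇒∃ : ∀ {x A} q → FreshSemi (semi₀ q) H → ∀ t → Closed t →
         Rule H right (rpl (ex x A))
           [ ⟨ [] , [ semi₀ q ]
             ∣ ([ semi₀ q ] ⇒ [ rpl (ex x A) ])
             ∷ ([ semi₀ q ] ⇒ [ rpl (A [ t / x ]) ])
             ∷ [] ⟩ ]

    ∃⇒ : ∀ {x A} a → FreshParam a H →
         Rule H left (rpl (ex x A))
           [ ⟨ [ rpl (A [ parameter a / x ]) ] , [] ∣ [] ⟩ ]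

  erase : ∀ s S {F} → F ∈ members s S → Sequent
  erase left  S m = (ante S ─ m) ⇒ succ S
  erase right S m = ante S ⇒ (succ S ─ m)

  _⊕_ : Sequent → Replacement → Sequent
  S ⊕ R = addAnte R ++ ante S ⇒ addSucc R ++ succ S

  premise : ∀ {H} → Occurrence H → Replacement → Hypersequent
  premise {H} o R =
    (erase (side o) (sequent o) (member o) ⊕ R) ∷ (extra R ++ (H ─ position o))

  ----------------------------------------------------------------------
  -- Ancestors

  unerase : ∀ {A : Set} {x y : A} {xs} (m : x ∈ xs) → y ∈ (xs ─ m) → y ∈ xs
  unerase (here _)  k         = there k
  unerase (there m) (here e)  = here e
  unerase (there m) (there k) = there (unerase m k)

  unerase-member : ∀ s S {F} (m : F ∈ members s S) s′ {G} →
                   G ∈ members s′ (erase s S m) → G ∈ members s′ S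
  unerase-member left  S m left  k = unerase m k
  unerase-member left  S m right k = k
  unerase-member right S m left  k = k
  unerase-member right S m right k = unerase m k

  -- Every occurrence in a premise is an immediate ancestor of exactly one
  -- occurrence in the conclusion: the principal one if it is displayed in
  -- the premise, and the one it is a copy of otherwise.
  immediateDescendant : ∀ {H} (o : Occurrence H) R →
                        Occurrence (premise o R) → Occurrence H
  immediateDescendant o R (occurrence (here refl) left m)
    with ++⁻ (addAnte R) m
  ... | inj₁ _ = o
  ... | inj₂ k = occurrence (position o) left
                   (unerase-member (side o) (sequent o) (member o) left k)
  immediateDescendant o R (occurrence (here refl) right m)
    with ++⁻ (addSucc R) m
  ... | inj₁ _ = o
  ... | inj₂ k = occurrence (position o) right
                   (unerase-member (side o) (sequent o) (member o) right k)
  immediateDescendant o R (occurrence (there i) s m)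
    with ++⁻ (extra R) i
  ... | inj₁ _ = o
  ... | inj₂ j = occurrence (unerase (position o) j) s m

  -- A step from the conclusion of a rule application to one of its premises.
  data Step (H : Hypersequent) : Hypersequent → Set where
    step : (o : Occurrence H) {Rs : List Replacement}
           (r : Rule H (side o) (formula o) Rs)
           {R : Replacement} (k : R ∈ Rs) → Step H (premise o R)

  principal : ∀ {H K} → Step H K → Occurrence H
  principal (step o _ _) = o

  data ImmediateAncestor {H} : ∀ {K} → Step H K →
                               Occurrence K → Occurrence H → Set where
    immediate : ∀ {o Rs} {r : Rule H (side o) (formula o) Rs}
                {R} {k : R ∈ Rs} (o′ : Occurrence (premise o R)) →
                ImmediateAncestor (step o r k) o′ (immediateDescendant o R o′)

  Path : Hypersequent → Hypersequent → Set
  Path = Star Step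

  data Ancestor : ∀ {H K} → Path H K → Occurrence K → Occurrence H → Set where
    ε   : ∀ {H} {o : Occurrence H} → Ancestor ε o o
    _◅_ : ∀ {H K L} {s : Step H K} {π : Path K L} {o″ o′ o} →
          ImmediateAncestor s o′ o → Ancestor π o″ o′ → Ancestor (s ◅ π) o″ o

  ----------------------------------------------------------------------
  -- Proof search trees

  data Tree (H : Hypersequent) : Set where
    leaf : Tree H
    node : (o : Occurrence H) {Rs : List Replacement} →
           Rule H (side o) (formula o) Rs →
           All (λ R → Tree (premise o R)) Rs → Tree H

  data Leaf : ∀ {H} → Tree H → Hypersequent → Set where
    here  : ∀ {H} → Leaf {H} leaf H
    there : ∀ {H K o Rs} {r : Rule H (side o) (formula o) Rs} {Ds R}
            (k : R ∈ Rs) → Leaf (All.lookup Ds k) K → Leaf (node o r Ds) K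

  IsProof : ∀ {H} → Tree H → Set₁
  IsProof D = ∀ K → Leaf D K → Axiom K

  Provable : Hypersequent → Set₁
  Provable H = ∃[ D ] IsProof {H} D

  extend : ∀ {H K} (D : Tree H) → Leaf D K → (o : Occurrence K) →
           ∀ {Rs} → Rule K (side o) (formula o) Rs → Tree H
  extend leaf           here        o r = node o r (All.universal (λ _ → leaf) _)
  extend (node o′ r′ Ds) (there k ℓ) o r =
    node o′ r′ (Ds All.[ k ]≔ extend (All.lookup Ds k) ℓ o r)

  infix 4 _∈ᵀ_

  -- The nodes of a tree are identified with the paths leading to them.
  data _∈ᵀ_ : ∀ {H K} → Path H K → Tree H → Set where
    root  : ∀ {H} {D : Tree H} → ε ∈ᵀ D
    child : ∀ {H K o Rs} {r : Rule H (side o) (formula o) Rs} {Ds R}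
            {k : R ∈ Rs} {π : Path (premise o R) K} →
            π ∈ᵀ All.lookup Ds k → (step o r k ◅ π) ∈ᵀ node o r Ds

  ----------------------------------------------------------------------
  -- Tactics

  record Target {H} (D : Tree H) : Set where
    field
      {label}   : Hypersequent
      atLeaf    : Leaf D label
      selected  : Occurrence label
      nonAtomic : ¬ Atom (formula selected)

  open Target public

  NoLogicalSymbols : ∀ {H} → Tree H → Set
  NoLogicalSymbols D = ∀ K → Leaf D K → All (AllMembers Atom) K

  Tactic : Set
  Tactic = ∀ H (D : Tree H) → NoLogicalSymbols D ⊎ Target D

  data Result (𝔱 : Tactic) {H} (D : Tree H) : Tree H → Set where
    stop  : ∀ {done} → 𝔱 _ D ≡ inj₁ done → Result 𝔱 D D
    apply : ∀ {g} → 𝔱 _ D ≡ inj₂ g →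
            ∀ {Rs} (r : Rule (label g) (side (selected g))
                                       (formula (selected g)) Rs) →
            Result 𝔱 D (extend D (atLeaf g) (selected g) r)

  Constructible : (𝔱 : Tactic) → ∀ {H} → Tree H → Set
  Constructible 𝔱 D = Star (Result 𝔱) leaf D

  record Run (𝔱 : Tactic) (H : Hypersequent) : Set where
    field
      stage   : ℕ → Tree H
      initial : stage 0 ≡ leaf
      next    : ∀ n → Result 𝔱 (stage n) (stage (suc n))

  NodeSet : Hypersequent → Set₁
  NodeSet H = ∀ {K} → Path H K → Set

  -- The possibly infinite tree obtained by a run, as a set of nodes.
  Limit : ∀ {𝔱 H} → Run 𝔱 H → NodeSet H
  Limit run π = ∃[ n ] π ∈ᵀ Run.stage run n

  _≼_ : ∀ {H K L} → Path H K → Path H L → Set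
  π ≼ π′ = ∃[ ρ ] π ◅◅ ρ ≡ π′

  Comparable : ∀ {H K L} → Path H K → Path H L → Set
  Comparable π π′ = π ≼ π′ ⊎ π′ ≼ π

  -- Branches are maximal chains of nodes.
  record IsBranch {H} (T B : NodeSet H) : Set where
    field
      within  : ∀ {K} {π : Path H K} → B π → T π
      chain   : ∀ {K L} {π : Path H K} {π′ : Path H L} →
                B π → B π′ → Comparable π π′
      maximal : ∀ {K} {π : Path H K} → T π →
                (∀ {L} {π′ : Path H L} → B π′ → Comparable π π′) → B π

  -- The rule application at a node π ◅◅ ρ lies on B when B contains a child
  -- of that node.
  Fair : Tactic → Set₁
  Fair 𝔱 =
    ∀ {H} (run : Run 𝔱 H) (B : NodeSet H) → IsBranch (Limit run) B →
    ∀ {K} {π : Path H K} → B π →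
    (o : Occurrence K) → ¬ Atom (formula o) →
    ∃[ L ] Σ (Path K L) λ ρ → ∃[ L′ ] Σ (Step L L′) λ s →
      B (π ◅◅ ρ ◅◅ s ◅ ε) × Ancestor ρ (principal s) o

{-# OPTIONS --safe #-}

-- Every rule is height-preserving invertible, for every choice of the term,
-- parameter or semipropositional variable it introduces.  Follow the given
-- strategy from 𝒢, and whenever the selected occurrence is principal at the end
-- of a proof of its leaf, choose the term as in the shortest such proof.  If no
-- stage were a proof, then the limit tree would have a branch of nodes above
-- which no finite stage is a proof.  At a node of this branch with a proof of
-- height n + 1, let o be the principal occurrence of the last inference.  As
-- long as no ancestor of o is selected, inversion preserves a proof of height
-- n + 1 ending with an inference on the copy of o; by fairness that copy is
-- eventually selected, and the premises then have proofs of height n.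
-- Descending to height 0 yields an axiom on the branch, which is absurd.
module Submission where

open import Defs
open import Algebra.Bundles using (module CommutativeMonoid)
import Algebra.Properties.CommutativeSemigroup as CommutativeSemigroup
open import Axiom.ExcludedMiddle using (ExcludedMiddle)
open import Data.Empty using (⊥-elim)
open import Data.List using (List; []; _∷_; [_]; _++_; map; foldr)
open import Data.List.Membership.Propositional using (_∈_; _∉_; _─_)
import Data.List.Membership.Setoid as Membership
import Data.List.Properties as List
import Data.List.Relation.Binary.Permutation.Setoid as Permutation
import Data.List.Relation.Binary.Permutation.Setoid.Properties as PermutationProperties
open import Data.List.Relation.Unary.All as All using (All; []; _∷_)
import Data.List.Relation.Unary.All.Properties as All
open import Data.List.Relation.Unary.Any as Any using (Any; here; there)
import Data.List.Relation.Unary.Any.Properties as Any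
open import Data.Maybe using (Maybe; just; nothing)
open import Data.Nat as ℕ using (ℕ; zero; suc; _⊔_)
import Data.Nat.Properties as ℕ
open import Data.Product as Product using (Σ; ∃-syntax; _×_; _,_; proj₁; proj₂)
open import Data.Rational as ℚ using (ℚ; 0ℚ; 1ℚ; ½)
import Data.Rational.Properties as ℚ
open import Data.Rational.Solver using (module +-*-Solver)
open import Data.Sum using (_⊎_; inj₁; inj₂; swap)
open import Data.Unit using (⊤; tt)
open import Data.Vec using (Vec; []; _∷_)
import Data.Vec.Relation.Unary.All as Vec
import Data.Vec.Relation.Unary.Any as Vec
open import Function using (_∘_; id)
open import Level using (0ℓ; lift; lower) renaming (suc to lsuc)
open import Relation.Binary.Bundles using (Setoid)
open import Relation.Binary.Construct.Closure.ReflexiveTransitive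
  using (ε; _◅_; _◅◅_)
open import Relation.Binary.Construct.Closure.ReflexiveTransitive.Properties
  using (◅◅-assoc)
open import Relation.Binary.PropositionalEquality
  using (_≡_; _≢_; refl; sym; trans; cong; cong₂; subst; setoid)
open import Relation.Nullary using (¬_; contradiction; yes; no)
import Relation.Nullary.Decidable as Dec

open Real using (ℝ; 0ℝ; 1ℝ; fromℚ)

-- The tactic sees the whole tree and may keep expanding below an axiom, so a given proof cannot be
-- replayed: its inferences have to survive arbitrary rule applications made in between. Two
-- features of the calculus allow this. A sequent with a compound member is never the true atomic
-- sequent of an axiom, so decomposing it leaves validity intact, and inversion costs no height even
-- at height 0. And the quantifier rules that use a term keep the quantified formula in a sequent of
-- its own, so a premise built with the wrong term can still be continued with the right one.
-- Fairness speaks only of branches of the limit of an entire infinite run. The run must therefore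
-- be fixed before any branch or height is known, and its failure is refuted only afterwards. The
-- argument is classical: excluded middle compares reals, decides whether some proof ends at a given
-- occurrence, and picks the child to follow. It is assumed for `Set₁` because axioms quantify over
-- all interpretations.

lowerEM : ExcludedMiddle (lsuc 0ℓ) → ExcludedMiddle 0ℓ
lowerEM em = Dec.map′ lower (lift {ℓ = lsuc 0ℓ}) em

-- Lists up to permutation and families over list positions

module _ {a ℓ} (A : Setoid a ℓ) where
  open Setoid A using (Carrier; _≈_)
  open Permutation A using (_↭_; prep; ↭-refl; ↭-sym; ↭-trans; ↭-prep; ↭-swap)
  open PermutationProperties A using (drop-∷; ∈-resp-↭)
  open Membership A using () renaming (_∈_ to _∈ₛ_)

  ∈⇒↭∷ : ∀ {x xs} → x ∈ₛ xs → ∃[ ys ] xs ↭ x ∷ ys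
  ∈⇒↭∷ {xs = _ ∷ xs} (here x≈y) = xs , prep (Setoid.sym A x≈y) ↭-refl
  ∈⇒↭∷ {xs = y ∷ xs} (there i)  =
    let ys , p = ∈⇒↭∷ i in
    y ∷ ys , ↭-trans (↭-prep y p) (↭-swap y _ ↭-refl)

  -- This is the case split of inversion between the principal occurrence and a side occurrence. It
  -- is applied twice: to the sequents of a hypersequent and to the members of a sequent.
  ∷↭∷⁻ : ∀ {x y xs ys} → x ∷ xs ↭ y ∷ ys →
         (x ≈ y × xs ↭ ys) ⊎ (∃[ zs ] xs ↭ y ∷ zs × ys ↭ x ∷ zs)
  ∷↭∷⁻ {x} {y} p with ∈-resp-↭ (↭-sym p) (here (Setoid.refl A))
  ... | here y≈x = inj₁ (Setoid.sym A y≈x , drop-∷ (↭-trans p (prep y≈x ↭-refl)))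
  ... | there i  =
    let zs , q = ∈⇒↭∷ i in
    inj₂ (zs , q , drop-∷ (↭-trans (↭-sym p)
                    (↭-trans (↭-prep x q) (↭-swap x y ↭-refl))))

  map-─ : ∀ {B : Set} (f : B → Carrier) {x xs} (m : x ∈ xs) →
          map f xs ↭ f x ∷ map f (xs ─ m)
  map-─ f (here refl) = ↭-refl
  map-─ f (there m)   =
    ↭-trans (↭-prep _ (map-─ f m)) (↭-swap _ _ ↭-refl)

  ∈-map : ∀ {B : Set} (f : B → Carrier) {y} xs → y ∈ₛ map f xs →
          Σ B λ x → x ∈ xs × y ≈ f x
  ∈-map f (x ∷ xs) (here e)  = x , here refl , e
  ∈-map f (x ∷ xs) (there i) = let x′ , j , e = ∈-map f xs i in x′ , there j , e

++⁻-─ : ∀ {A : Set} (ys : List A) {xs x} (m : x ∈ ys ++ xs) {k} →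
        Any.++⁻ ys m ≡ inj₂ k → (ys ++ xs) ─ m ≡ ys ++ (xs ─ k)
++⁻-─ []       m         refl = refl
++⁻-─ (y ∷ ys) (here e)  ()
++⁻-─ (y ∷ ys) (there m) eq with Any.++⁻ ys m in eq′
++⁻-─ (y ∷ ys) (there m) refl | inj₂ k = cong (y ∷_) (++⁻-─ ys m eq′)

-- `Q` depends on the position so that it can relate the updated family to another family at the
-- same index, as when a tree is compared with its extension.
lookup-≔ : ∀ {a p q} {A : Set a} {P : A → Set p} {xs : List A}
  (Q : ∀ {x} → x ∈ xs → P x → Set q) (ps : All P xs) {x} (i : x ∈ xs) {p} →
  Q i p → (∀ {y} (j : y ∈ xs) → Q j (All.lookup ps j)) →
  ∀ {y} (j : y ∈ xs) → Q j (All.lookup (ps All.[ i ]≔ p) j)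
lookup-≔ Q (_ ∷ ps) (here refl) q qs (here refl) = q
lookup-≔ Q (_ ∷ ps) (here refl) q qs (there j)   = qs (there j)
lookup-≔ Q (_ ∷ ps) (there i)   q qs (here refl) = qs (here refl)
lookup-≔ Q (_ ∷ ps) (there i)   q qs (there j)   =
  lookup-≔ (λ k → Q (there k)) ps i q (λ k → qs (there k)) j

-- Monotonicity lets the maximum of finitely many individual bounds serve all positions. This is the
-- finiteness step of the branch construction.
uniformBound : ∀ {a p} {A : Set a} {xs : List A} (P : ∀ {x} → x ∈ xs → ℕ → Set p) →
  (∀ {x} (i : x ∈ xs) {m n} → m ℕ.≤ n → P i m → P i n) →
  (∀ {x} (i : x ∈ xs) → ∃[ n ] P i n) → ∃[ n ] ∀ {x} (i : x ∈ xs) → P i n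
uniformBound {xs = []}     P mono f = 0 , λ ()
uniformBound {xs = x ∷ xs} P mono f =
  let m , p = f (here refl)
      n , q = uniformBound (λ i → P (there i)) (λ i → mono (there i)) (λ i → f (there i))
  in m ⊔ n , λ { (here refl) → mono (here refl) (ℕ.m≤m⊔n m n) p
               ; (there i)   → mono (there i) (ℕ.m≤n⊔m m n) (q i) }

lookup-universal : ∀ {a p} {A : Set a} {P : A → Set p} (f : ∀ x → P x) {xs : List A}
  {x} (i : x ∈ xs) → All.lookup (All.universal f xs) i ≡ f x
lookup-universal f (here refl) = refl
lookup-universal f (there i)   = lookup-universal f i

-- Nonnegativity of reals on their rational sequences

Nonneg : (ℕ → ℚ) → Set
Nonneg f = ∀ δ → 0ℚ ℚ.< δ → ∃[ N ] ∀ n → N ℕ.≤ n → 0ℚ ℚ.≤ f n ℚ.+ δ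

-- On bare sequences, `0ℝ Real.≤ x` transfers along termwise equality. Sums can thus be rearranged
-- by rational identities, without carrying Cauchy moduli.
Nonneg-resp : ∀ {f g} → (∀ n → f n ≡ g n) → Nonneg f → Nonneg g
Nonneg-resp f≗g nn δ 0<δ =
  let N , p = nn δ 0<δ in
  N , λ n N≤n → subst (λ q → 0ℚ ℚ.≤ q ℚ.+ δ) (f≗g n) (p n N≤n)

private
  half-pos : ∀ {δ} → 0ℚ ℚ.< δ → 0ℚ ℚ.< ½ ℚ.* δ
  half-pos {δ} 0<δ =
    subst (ℚ._< ½ ℚ.* δ) (ℚ.*-zeroʳ ½) (ℚ.*-monoʳ-<-pos ½ 0<δ)

  p≤∣p∣ : ∀ p → p ℚ.≤ ℚ.∣ p ∣
  p≤∣p∣ p with ℚ.≤-total 0ℚ p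
  ... | inj₁ 0≤p = ℚ.≤-reflexive (sym (ℚ.0≤p⇒∣p∣≡p 0≤p))
  ... | inj₂ p≤0 = ℚ.≤-trans p≤0 (ℚ.0≤∣p∣ p)

  half+half : ∀ δ → ½ ℚ.* δ ℚ.+ ½ ℚ.* δ ≡ δ
  half+half δ = trans (sym (ℚ.*-distribʳ-+ δ ½ ½)) (ℚ.*-identityˡ δ)

Nonneg-+ : ∀ {f g} → Nonneg f → Nonneg g → Nonneg (λ n → f n ℚ.+ g n)
Nonneg-+ {f} {g} nf ng δ 0<δ =
  let M , p = nf (½ ℚ.* δ) (half-pos 0<δ)
      N , q = ng (½ ℚ.* δ) (half-pos 0<δ)
  in M ℕ.⊔ N , λ n M⊔N≤n →
    subst (0ℚ ℚ.≤_)
      (trans (CommutativeSemigroup.interchange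
        (CommutativeMonoid.commutativeSemigroup ℚ.+-0-commutativeMonoid) (f n) _ (g n) _)
             (cong (f n ℚ.+ g n ℚ.+_) (half+half δ)))
      (ℚ.+-mono-≤ (p n (ℕ.m⊔n≤o⇒m≤o M N M⊔N≤n)) (q n (ℕ.m⊔n≤o⇒n≤o M N M⊔N≤n)))

-- If the terms are not eventually nonnegative, a negative term occurs beyond every Cauchy modulus.
-- All terms beyond the modulus for δ are then at most δ.
Nonneg-total : ExcludedMiddle 0ℓ → (x : ℝ) →
               Nonneg (ℝ.seq x) ⊎ Nonneg (λ n → ℚ.- ℝ.seq x n)
Nonneg-total em x with em {∃[ N ] ∀ n → N ℕ.≤ n → 0ℚ ℚ.≤ ℝ.seq x n}
... | yes (N , p) = inj₁ λ δ 0<δ → N , λ n N≤n →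
  ℚ.≤-trans (p n N≤n)
    (subst (ℚ._≤ ℝ.seq x n ℚ.+ δ) (ℚ.+-identityʳ _)
      (ℚ.+-monoʳ-≤ (ℝ.seq x n) (ℚ.<⇒≤ 0<δ)))
... | no ¬p = inj₂ λ δ 0<δ → go δ (ℝ.cauchy x δ 0<δ)
  where
  go : ∀ δ → (∃[ N ] ∀ m n → N ℕ.≤ m → N ℕ.≤ n →
                 ℚ.∣ ℝ.seq x m ℚ.- ℝ.seq x n ∣ ℚ.≤ δ) →
       ∃[ N ] ∀ n → N ℕ.≤ n → 0ℚ ℚ.≤ ℚ.- ℝ.seq x n ℚ.+ δ
  go δ (N , close) with em {∃[ n ] N ℕ.≤ n × ℝ.seq x n ℚ.< 0ℚ}
  ... | no ¬q = contradiction
    (N , λ n N≤n → ℚ.≮⇒≥ λ neg → ¬q (n , N≤n , neg)) ¬p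
  -- As `xn` is negative, `xm` is below `xm - xn`, which is at most `δ`.
  ... | yes (n , N≤n , neg) = N , λ m N≤m →
    let xm = ℝ.seq x m ; xn = ℝ.seq x n in
    subst (ℚ._≤ ℚ.- xm ℚ.+ δ) (ℚ.+-inverseˡ xm)
     (ℚ.+-monoʳ-≤ (ℚ.- xm)
      (ℚ.≤-trans
        (subst (ℚ._≤ xm ℚ.- xn) (ℚ.+-identityʳ xm)
          (ℚ.+-monoʳ-≤ xm (ℚ.<⇒≤ (ℚ.neg-antimono-< neg))))
        (ℚ.≤-trans (p≤∣p∣ _) (close m n N≤m N≤n))))

-- Signed hypersequents and their semantics

module FairSearch (em : ExcludedMiddle (lsuc 0ℓ)) (sig : Signature) where

  open Signature sig
  open Calculus sig

  -- Attaching the side to each member lets one argument treat left and right rules alike.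
  Seq Hyp : Set
  Seq = List (Side × Formula)
  Hyp = List Seq

  module S  = Permutation (setoid (Side × Formula))
  module SP = PermutationProperties (setoid (Side × Formula))
  module H  = Permutation S.↭-setoid
  module HP = PermutationProperties S.↭-setoid
  open S using (_↭_)

  infix 3 _≈_
  _≈_ : Hyp → Hyp → Set
  _≈_ = H._↭_

  signed : List Formula → List Formula → Seq
  signed Γ Δ = map (left ,_) Γ ++ map (right ,_) Δ

  flatS : Sequent → Seq
  flatS (Γ ⇒ Δ) = signed Γ Δ

  flat : Hypersequent → Hyp
  flat = map flatS

  expand : Replacement → Seq → Hyp → Hyp
  expand R S G = (signed (addAnte R) (addSucc R) ++ S) ∷ (flat (extra R) ++ G)

  opposite : Side → Side
  opposite left  = right
  opposite right = left

  sign : Side → ℚ → ℚ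
  sign left  q = ℚ.- q
  sign right q = q

  module _ (M : Interpretation) (ν : Valuation M) where
    open Interpretation M

    -- The value of compound formulas is a dummy: `True` separately demands that all members are
    -- atoms.
    valueOf : Formula → ℝ
    valueOf (rpl (pred P ts))   = predᴹ P (termValues M ν ts)
    valueOf (rpl (const r _ _)) = fromℚ r
    valueOf (rpl (_ ⊃ _))       = 0ℝ
    valueOf (rpl (all _ _))     = 0ℝ
    valueOf (rpl (ex _ _))      = 0ℝ
    valueOf (semi₁ i)           = semi₁ᴹ i
    valueOf (semi₀ i)           = semi₀ᴹ i

    weight : Side × Formula → ℕ → ℚ
    weight (s , F) n = sign s (ℝ.seq (valueOf F Real.- 1ℝ) n)

    -- With antecedent members counted negatively, the difference between succedent and antecedent
    -- is a single sum, invariant under permutation.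
    total : Seq → ℕ → ℚ
    total S n = foldr ℚ._+_ 0ℚ (map (λ x → weight x n) S)

    True : Seq → Set
    True S = All (Atom ∘ proj₂) S × Nonneg (total S)

    total-resp : ∀ {S T} → S ↭ T → ∀ n → total S n ≡ total T n
    total-resp p n = PermutationProperties.foldr-commMonoid
      (setoid ℚ) ℚ.+-0-isCommutativeMonoid
      (SP.map⁺ (setoid ℚ) (cong (λ x → weight x n)) p)

    True-resp : ∀ {S T} → S ↭ T → True S → True T
    True-resp p (atoms , nn) =
      SP.All-resp-↭ (λ { refl a → a }) p atoms , Nonneg-resp (total-resp p) nn

    sign-total : ∀ s (x : ℝ) → Nonneg (λ n → sign s (ℝ.seq x n)) ⊎
                               Nonneg (λ n → sign (opposite s) (ℝ.seq x n))
    sign-total left  x = swap (Nonneg-total (lowerEM em) x)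
    sign-total right x = Nonneg-total (lowerEM em) x

    -- The signed difference of `u` and `v` is the total of the two-member sequent, where the
    -- offsets 1 cancel. If it is not nonnegative, its negative is, and adding that to the given
    -- total turns `u` into `v`.
    True-cut : ∀ s {u v S} → Atom v → True ((s , u) ∷ S) →
               True ((s , v) ∷ S) ⊎ True ((s , u) ∷ (opposite s , v) ∷ [])
    True-cut s {u} {v} {S} av (au ∷ as , nn)
      with sign-total s (valueOf u Real.- valueOf v)
    ... | inj₁ nn′ = inj₂
      (au ∷ av ∷ [] ,
       Nonneg-resp (λ n → eq s (ℝ.seq (valueOf u) n) (ℝ.seq (valueOf v) n)) nn′)
      where
      open +-*-Solver
      eq : ∀ s p q → sign s (p ℚ.- q) ≡
           sign s (p ℚ.- 1ℚ) ℚ.+ (sign (opposite s) (q ℚ.- 1ℚ) ℚ.+ 0ℚ)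
      eq left  = solve 2 (λ p q → :- (p :- q) :=
        :- (p :- con 1ℚ) :+ ((q :- con 1ℚ) :+ con 0ℚ)) refl
      eq right = solve 2 (λ p q → p :- q :=
        (p :- con 1ℚ) :+ (:- (q :- con 1ℚ) :+ con 0ℚ)) refl
    ... | inj₂ nn′ = inj₁
      (av ∷ as ,
       Nonneg-resp
         (λ n → eq s (ℝ.seq (valueOf u) n) (ℝ.seq (valueOf v) n) (total S n))
         (Nonneg-+ {total ((s , u) ∷ S)}
           {λ n → sign (opposite s) (ℝ.seq (valueOf u Real.- valueOf v) n)} nn nn′))
      where
      open +-*-Solver
      eq : ∀ s p q r → sign s (p ℚ.- 1ℚ) ℚ.+ r ℚ.+ sign (opposite s) (p ℚ.- q)
           ≡ sign s (q ℚ.- 1ℚ) ℚ.+ r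
      eq left  = solve 3 (λ p q r → :- (p :- con 1ℚ) :+ r :+ (p :- q) :=
        :- (q :- con 1ℚ) :+ r) refl
      eq right = solve 3 (λ p q r → (p :- con 1ℚ) :+ r :+ :- (p :- q) :=
        (q :- con 1ℚ) :+ r) refl

  -- Validity and height-bounded provability

  Valid : Hyp → Set₁
  Valid H = ∀ M (ν : Valuation M) → Any (True M ν) H

  Valid-resp : ∀ {H K} → H ≈ K → Valid H → Valid K
  Valid-resp p v M ν = HP.Any-resp-↭ (True-resp M ν) p (v M ν)

  -- The name c serves as the semipropositional variable or the parameter of
  -- the rule; c and t are ignored by the rules that do not need them.
  inst : Side → RPL → ℕ → Term → List Replacement
  inst left  (A ⊃ B)   c t =
    [ ⟨ [ semi₁ c ] , [] ∣ [ [ rpl B ] ⇒ semi₁ c ∷ rpl A ∷ [] ] ⟩ ]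
  inst right (A ⊃ B)   c t =
    ⟨ [] , [] ∣ [] ⟩ ∷ ⟨ [ rpl A ] , [ rpl B ] ∣ [] ⟩ ∷ []
  inst left  (all x A) c t =
    [ ⟨ [ semi₁ c ] , []
      ∣ ([ rpl (all x A) ] ⇒ [ semi₁ c ])
      ∷ ([ rpl (A [ t / x ]) ] ⇒ [ semi₁ c ]) ∷ [] ⟩ ]
  inst right (all x A) c t = [ ⟨ [] , [ rpl (A [ parameter c / x ]) ] ∣ [] ⟩ ]
  inst left  (ex x A)  c t = [ ⟨ [ rpl (A [ parameter c / x ]) ] , [] ∣ [] ⟩ ]
  inst right (ex x A)  c t =
    [ ⟨ [] , [ semi₀ c ]
      ∣ ([ semi₀ c ] ⇒ [ rpl (ex x A) ])
      ∷ ([ semi₀ c ] ⇒ [ rpl (A [ t / x ]) ]) ∷ [] ⟩ ]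
  inst _ (pred _ _)    c t = []
  inst _ (const _ _ _) c t = []

  Compound : RPL → Set
  Compound A = ¬ Atom (rpl A)

  -- The premises are required for all names c, fresh or not: as a fresh name
  -- can be renamed to any other, this does not change provability, and no
  -- freshness condition has to be maintained under inversion.
  data Prv : ℕ → Hyp → Set₁ where
    valid : ∀ {n H} → Valid H → Prv n H
    infer : ∀ {n H S G t} s A → Compound A → Closed t →
            H ≈ ((s , rpl A) ∷ S) ∷ G →
            (∀ c {R} → R ∈ inst s A c t → Prv n (expand R S G)) →
            Prv (suc n) H

  Prv-suc : ∀ {n H} → Prv n H → Prv (suc n) H
  Prv-suc (valid v) = valid v
  Prv-suc (infer s A cA ct p prems) =
    infer s A cA ct p λ c k → Prv-suc (prems c k)

  Prv-mono : ∀ {m n H} → m ℕ.≤ n → Prv m H → Prv n H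
  Prv-mono _           (valid v)                 = valid v
  Prv-mono (ℕ.s≤s m≤n) (infer s A cA ct p prems) =
    infer s A cA ct p λ c k → Prv-mono m≤n (prems c k)

  Prv-resp : ∀ {n H K} → H ≈ K → Prv n H → Prv n K
  Prv-resp p (valid v)                 = valid (Valid-resp p v)
  Prv-resp p (infer s A cA ct q prems) =
    infer s A cA ct (H.↭-trans (H.↭-sym p) q) prems

  expand-resp : ∀ R {S T G K} → S ↭ T → G ≈ K → expand R S G ≈ expand R T K
  expand-resp R p q = H.prep (SP.++⁺ˡ _ p) (HP.++⁺ˡ _ q)

  -- No freshness clash can arise: the premises are available for every name, including those that
  -- occur in `W`.
  weaken : ∀ W {n H} → Prv n H → Prv n (W ∷ H)
  weaken W (valid v)                 = valid λ M ν → there (v M ν)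
  weaken W (infer s A cA ct p prems) =
    infer s A cA ct
      (H.↭-trans (H.↭-prep W p) (H.↭-swap W _ H.↭-refl))
      λ c {R} k → Prv-resp (H.↭-sym (HP.↭-shift (_ ∷ flat (extra R)) _))
                           (weaken W (prems c k))

  -- Inversion

  module _ {x L E} (n : ℕ)
    (replace : ∀ {H S G} → Prv n H → H ≈ (x ∷ S) ∷ G →
               Prv n ((L ++ S) ∷ (E ++ G)))
    where

    replace-same : ∀ {Z G G′} L′ E′ → G ≈ G′ → ∀ {S} → S ↭ x ∷ Z →
      Prv n ((L′ ++ S) ∷ (E′ ++ G)) →
      Prv n ((L′ ++ (L ++ Z)) ∷ (E′ ++ (E ++ G′)))
    replace-same L′ E′ q p d =
      Prv-resp (H.prep (SP.shifts L L′) (HP.shifts E E′))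
        (replace d (H.prep (S.↭-trans (SP.++⁺ˡ L′ p) (SP.↭-shift L′ _))
                           (HP.++⁺ˡ E′ q)))

    replace-other : ∀ {S S′ Q G} L′ E′ → G ≈ (x ∷ S) ∷ Q →
      Prv n ((L′ ++ S′) ∷ (E′ ++ G)) →
      Prv n ((L′ ++ S′) ∷ (E′ ++ ((L ++ S) ∷ (E ++ Q))))
    replace-other {S} {S′} L′ E′ q d =
      Prv-resp (HP.shifts ((L ++ S) ∷ E) ((L′ ++ S′) ∷ E′))
        (replace d (H.↭-trans (HP.++⁺ˡ ((L′ ++ S′) ∷ E′) q)
                              (HP.↭-shift ((L′ ++ S′) ∷ E′) _)))

    -- The inductive step shared by `cut` and `invert`. If the last inference acts on another
    -- sequent, or on another member of the same sequent, it is permuted below the replacement. Only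
    -- the case where `x` itself is principal is left to the caller.
    replace-suc :
      (∀ {s A t S G} → Closed t → (s , rpl A) ≡ x → Compound A →
        (∀ c {R} → R ∈ inst s A c t → Prv n (expand R S G)) →
        Prv (suc n) ((L ++ S) ∷ (E ++ G))) →
      (∀ {H S G} → Valid H → H ≈ (x ∷ S) ∷ G → Valid ((L ++ S) ∷ (E ++ G))) →
      ∀ {H S G} → Prv (suc n) H → H ≈ (x ∷ S) ∷ G →
      Prv (suc n) ((L ++ S) ∷ (E ++ G))
    replace-suc principal sound (valid v) p = valid (sound v p)
    replace-suc principal sound (infer s A cA ct q prems) p
      with ∷↭∷⁻ S.↭-setoid (H.↭-trans (H.↭-sym q) p)
    ... | inj₂ (Q , r , r′) =
      infer s A cA ct
        (H.↭-trans (HP.++⁺ˡ (_ ∷ E) r′) (HP.↭-shift (_ ∷ E) _))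
        λ c {R} k → replace-other
          (signed (addAnte R) (addSucc R)) (flat (extra R)) r (prems c k)
    ... | inj₁ (r , r′) with ∷↭∷⁻ (setoid _) r
    ...   | inj₁ (refl , r″) =
      Prv-resp (H.prep (SP.++⁺ˡ L r″) (HP.++⁺ˡ E r′)) (principal ct refl cA prems)
    ...   | inj₂ (Z , z , z′) =
      infer s A cA ct
        (H.prep (S.↭-trans (SP.++⁺ˡ L z′) (SP.↭-shift L Z)) H.↭-refl)
        λ c {R} k → replace-same
          (signed (addAnte R) (addSucc R)) (flat (extra R)) r′ z (prems c k)

  -- If the sequent with u holds, then either the values of u and v allow the
  -- replacement of u by v, or they make the sequent comparing u and v true.
  cut : ∀ s {u v n H S G} → Atom u → Atom v → Prv n H → H ≈ ((s , u) ∷ S) ∷ G →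
        Prv n (((s , v) ∷ S) ∷ ((s , u) ∷ (opposite s , v) ∷ []) ∷ G)
  cut s {u} {v} {n} au av = go n
    where
    sound : ∀ {H S G} → Valid H → H ≈ ((s , u) ∷ S) ∷ G →
      Valid (((s , v) ∷ S) ∷ ((s , u) ∷ (opposite s , v) ∷ []) ∷ G)
    sound w p M ν with Valid-resp p w M ν
    ... | there k = there (there k)
    ... | here h with True-cut M ν s av h
    ...   | inj₁ h′ = here h′
    ...   | inj₂ h′ = there (here h′)
    go : ∀ n {H S G} → Prv n H → H ≈ ((s , u) ∷ S) ∷ G →
        Prv n (((s , v) ∷ S) ∷ ((s , u) ∷ (opposite s , v) ∷ []) ∷ G)
    go ℕ.zero (valid w) p = valid (sound w p)
    -- An atom is never principal, so the principal case is void.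
    go (suc n) = replace-suc {L = [ _ ]} {E = [ _ ]} n (go n)
      (λ { _ refl cA _ → contradiction au cA }) sound

  rotate : ∀ {W X Y U V : Seq} {G} → W ∷ X ∷ Y ∷ U ∷ V ∷ G ≈ Y ∷ U ∷ V ∷ X ∷ W ∷ G
  rotate {W} {X} {Y} {U} {V} {G} = H.↭-trans (H.↭-swap W X H.↭-refl)
    (HP.shifts (X ∷ W ∷ []) (Y ∷ U ∷ V ∷ []))

  -- In a quantifier rule with a term, the premise still contains the principal
  -- formula in a sequent of its own.  The rule is applied to that copy with the
  -- term t′ of the given inference, and cut links the two variables.
  invert-principal : ∀ {n s A c t t′ R S G} → R ∈ inst s A c t → Closed t′ →
    (∀ c {R} → R ∈ inst s A c t′ → Prv n (expand R S G)) →
    Prv (suc n) (expand R S G)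
  invert-principal {s = left}  {_ ⊃ _} {c} k _ prems = Prv-suc (prems c k)
  invert-principal {s = right} {_ ⊃ _} {c} k _ prems = Prv-suc (prems c k)
  invert-principal {s = right} {all _ _} {c} k _ prems = Prv-suc (prems c k)
  invert-principal {s = left}  {ex _ _} {c} k _ prems = Prv-suc (prems c k)
  invert-principal {s = left}  {all x A} (here refl) ct prems =
    infer left (all x A) (λ ()) ct (H.↭-swap _ _ H.↭-refl)
      λ { c (here refl) → Prv-resp rotate
            (weaken _ (cut left semi₁ semi₁ (prems c (here refl)) H.↭-refl)) }
  invert-principal {s = right} {ex x A} (here refl) ct prems =
    infer right (ex x A) (λ ()) ct
      (H.swap S.↭-refl (S.↭-swap _ _ S.↭-refl) H.↭-refl)
      λ { c (here refl) → Prv-resp rotate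
            (weaken _ (cut right semi₀ semi₀ (prems c (here refl)) H.↭-refl)) }

  -- At a valid hypersequent, the sequent that contains the compound `A` is not the true one, so the
  -- true sequent survives among the others. Above height 0, only a last inference on this very
  -- occurrence needs work.
  invert : ∀ {s A c t R n H S G} → Compound A → R ∈ inst s A c t →
           Prv n H → H ≈ ((s , rpl A) ∷ S) ∷ G → Prv n (expand R S G)
  invert {s} {A} {R = R} {n = n} cA k = go n
    where
    sound : ∀ {H S G} → Valid H → H ≈ ((s , rpl A) ∷ S) ∷ G → Valid (expand R S G)
    sound w p M ν with Valid-resp p w M ν
    ... | here (a ∷ _ , _) = contradiction a cA
    ... | there i          = there (Any.++⁺ʳ (flat (extra R)) i)
    go : ∀ n {H S G} → Prv n H → H ≈ ((s , rpl A) ∷ S) ∷ G → Prv n (expand R S G)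
    go ℕ.zero (valid w) p = valid (sound w p)
    go (suc n) = replace-suc n (go n)
      (λ { ct refl _ prems → invert-principal k ct prems }) sound

  -- Occurrences

  module _ {a ℓ} (A : Setoid a ℓ) where
    open Setoid A using (Carrier)
    open Permutation A using (↭-refl; ↭-trans; ↭-prep; ↭-swap) renaming (_↭_ to _↭ₛ_)

    map-─-unerase : ∀ {B : Set} (f : B → Carrier) {x y xs} (m : x ∈ xs)
                (k : y ∈ (xs ─ m)) →
                map f (xs ─ unerase m k) ↭ₛ f x ∷ map f ((xs ─ m) ─ k)
    map-─-unerase f (here refl) k        = ↭-refl
    map-─-unerase f (there m) (here e)   = map-─ A f m
    map-─-unerase f (there m) (there k)  =
      ↭-trans (↭-prep _ (map-─-unerase f m k)) (↭-swap _ _ ↭-refl)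

  restS : ∀ {H} → Occurrence H → Seq
  restS o = flatS (erase (side o) (sequent o) (member o))

  restG : ∀ {H} → Occurrence H → Hyp
  restG {H} o = flat (H ─ position o)

  flatS-erase : ∀ s S {F} (m : F ∈ members s S) →
                flatS S ↭ (s , F) ∷ flatS (erase s S m)
  flatS-erase left  S m = SP.++⁺ʳ _ (map-─ (setoid _) (left ,_) m)
  flatS-erase right S m = S.↭-trans
    (SP.++⁺ˡ _ (map-─ (setoid _) (right ,_) m))
    (SP.↭-shift (map (left ,_) (ante S)) _)

  flat-occurrence : ∀ {H} (o : Occurrence H) →
                    flat H ≈ ((side o , formula o) ∷ restS o) ∷ restG o
  flat-occurrence o = H.↭-trans (map-─ S.↭-setoid flatS (position o))
    (H.prep (flatS-erase (side o) (sequent o) (member o)) H.↭-refl)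

  flatS-⊕ : ∀ S R → flatS (S ⊕ R) ↭ signed (addAnte R) (addSucc R) ++ flatS S
  flatS-⊕ (Γ ⇒ Δ) R
    = begin
    signed (addAnte R ++ Γ) (addSucc R ++ Δ) ≡⟨ cong₂ _++_
      (List.map-++ _ (addAnte R) Γ) (List.map-++ _ (addSucc R) Δ) ⟩
    (a ++ b) ++ (c ++ d) ↭⟨ SP.++-assoc a b (c ++ d) ⟩
    a ++ (b ++ (c ++ d)) ↭⟨ SP.++⁺ˡ a (SP.shifts b c) ⟩
    a ++ (c ++ (b ++ d)) ↭⟨ SP.++-assoc a c (b ++ d) ⟨
    (a ++ c) ++ (b ++ d) ∎
    where
    open S.PermutationReasoning
    a = map (left ,_) (addAnte R)
    b = map (left ,_) Γ
    c = map (right ,_) (addSucc R)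
    d = map (right ,_) Δ

  flat-premise : ∀ {H} (o : Occurrence H) R →
                 flat (premise o R) ≈ expand R (restS o) (restG o)
  flat-premise {H} o R = H.prep (flatS-⊕ (erase (side o) (sequent o) (member o)) R)
    (H.↭-reflexive (List.map-++ flatS (extra R) (H ─ position o)))

  find-member : ∀ {s F} S → (s , F) ∈ flatS S → F ∈ members s S
  find-member (Γ ⇒ Δ) i with Any.++⁻ (map (left ,_) Γ) i
  ... | inj₁ j with ∈-map (setoid _) (left ,_) Γ j
  ...   | _ , k , refl = k
  find-member (Γ ⇒ Δ) i | inj₂ j with ∈-map (setoid _) (right ,_) Δ j
  ...   | _ , k , refl = k

  -- A permutation forgets positions, so any occurrence with the same formula in an equal sequent
  -- may be taken: cancelling it on both sides shows that the remainders agree.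
  find-occurrence : ∀ {K s F S G} → flat K ≈ ((s , F) ∷ S) ∷ G →
    ∃[ o ] side {K} o ≡ s × formula o ≡ F × S ↭ restS o × G ≈ restG o
  find-occurrence {K} {s} {F} {S} p
    with ∈-map S.↭-setoid flatS K (HP.∈-resp-↭ (H.↭-sym p) (here S.↭-refl))
  ... | T , i , q =
    let m  = find-member T (SP.∈-resp-↭ q (here refl)) in
    occurrence i s m , refl , refl ,
    SP.drop-∷ (S.↭-trans q (flatS-erase s T m)) ,
    HP.drop-∷ (H.↭-trans (H.prep (S.↭-sym q) H.↭-refl)
                (H.↭-trans (H.↭-sym p) (map-─ S.↭-setoid flatS i)))

  -- o is the principal occurrence of the last inference in some proof of K of
  -- height n + 1.
  record Inv {K} (n : ℕ) (o : Occurrence K) : Set₁ where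
    constructor inv
    field
      {matrix}  : RPL
      isRPL     : formula o ≡ rpl matrix
      compound  : Compound matrix
      {witness} : Term
      closed    : Closed witness
      premises  : ∀ c {R} → R ∈ inst (side o) matrix c witness →
                  Prv n (flat (premise o R))

  Prv⇒Inv : ∀ {n K} → Prv (suc n) (flat K) →
            Valid (flat K) ⊎ ∃[ o ] Inv {K} n o
  Prv⇒Inv (valid v) = inj₁ v
  Prv⇒Inv {n} {K} (infer {S = S} {G} {t} s A cA ct p prems) =
    let o , side≡ , formula≡ , q , r = find-occurrence p in
    inj₂ (o , build o side≡ formula≡ q r)
    where
    build : ∀ o → side {K} o ≡ s → formula o ≡ rpl A → S ↭ restS o →
            G ≈ restG o → Inv n o
    build o refl eq q r = inv eq cA ct λ c {R} k →
      Prv-resp (H.↭-trans (expand-resp R q r) (H.↭-sym (flat-premise o R)))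
               (prems c k)

  flatS-erase-unerase : ∀ s S {F} (m : F ∈ members s S) s′ {G}
    (k : G ∈ members s′ (erase s S m)) →
    flatS (erase s′ S (unerase-member s S m s′ k)) ↭
    (s , F) ∷ flatS (erase s′ (erase s S m) k)
  flatS-erase-unerase left  S m left  k =
    SP.++⁺ʳ _ (map-─-unerase (setoid _) (left ,_) m k)
  flatS-erase-unerase left  S m right k = SP.++⁺ʳ _ (map-─ (setoid _) (left ,_) m)
  flatS-erase-unerase right S m left  k = S.↭-trans
    (SP.++⁺ˡ _ (map-─ (setoid _) (right ,_) m))
    (SP.↭-shift (map (left ,_) (ante S ─ k)) _)
  flatS-erase-unerase right S m right k = S.↭-trans
    (SP.++⁺ˡ _ (map-─-unerase (setoid _) (right ,_) m k))
    (SP.↭-shift (map (left ,_) (ante S)) _)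

  flatS-erase-⊕ˡ : ∀ S R {F} (m : F ∈ addAnte R ++ ante S) {k} →
    Any.++⁻ (addAnte R) m ≡ inj₂ k →
    flatS (erase left (S ⊕ R) m) ≡ flatS (erase left S k ⊕ R)
  flatS-erase-⊕ˡ S R m eq =
    cong (λ Γ → flatS (Γ ⇒ addSucc R ++ succ S)) (++⁻-─ (addAnte R) m eq)

  flatS-erase-⊕ʳ : ∀ S R {F} (m : F ∈ addSucc R ++ succ S) {k} →
    Any.++⁻ (addSucc R) m ≡ inj₂ k →
    flatS (erase right (S ⊕ R) m) ≡ flatS (erase right S k ⊕ R)
  flatS-erase-⊕ʳ S R m eq =
    cong (λ Δ → flatS (addAnte R ++ ante S ⇒ Δ)) (++⁻-─ (addSucc R) m eq)

  module _ {H} (o : Occurrence H) (R : Replacement) {n}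
    (replace : ∀ {K S G} → Prv n K → K ≈ ((side o , formula o) ∷ S) ∷ G →
               Prv n (expand R S G)) where

    private
      L = signed (addAnte R) (addSucc R)
      E = flat (extra R)

      sameSequent : ∀ s {F} (k : F ∈ members s (erase (side o) (sequent o) (member o)))
        (m : F ∈ members s (erase (side o) (sequent o) (member o) ⊕ R)) →
        flatS (erase s (erase (side o) (sequent o) (member o) ⊕ R) m) ≡
        flatS (erase s (erase (side o) (sequent o) (member o)) k ⊕ R) →
        ∀ R′ →
        Prv n (flat (premise (occurrence (position o) s
           (unerase-member (side o) (sequent o) (member o) s k)) R′)) →
        Prv n (flat (premise {premise o R} (occurrence (here refl) s m) R′))
      sameSequent s k m eq R′ d =
        Prv-resp
          (H.↭-sym (H.↭-trans
            (flat-premise {premise o R} (occurrence (here refl) s m) R′)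
            (expand-resp R′
              (S.↭-trans (S.↭-reflexive eq) (flatS-⊕ (erase s S⁻ k) R))
              (H.↭-reflexive (List.map-++ flatS (extra R) _)))))
          (replace-same {L = L} {E = E} n replace
            (signed (addAnte R′) (addSucc R′)) (flat (extra R′)) H.↭-refl
            (flatS-erase-unerase (side o) (sequent o) (member o) s k)
            (Prv-resp (flat-premise (occurrence (position o) s
              (unerase-member (side o) (sequent o) (member o) s k)) R′) d))
        where S⁻ = erase (side o) (sequent o) (member o)

    -- Replacements at two different occurrences commute: inverting `o` inside a premise for `o₁`
    -- yields the corresponding premise for its copy `o′`. The inequality rules out the displayed
    -- occurrences, whose immediate descendant is `o`.
    replace-nonprincipal : (o′ : Occurrence (premise o R)) →
      let o₁ = immediateDescendant o R o′ in o₁ ≢ o →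
      side o₁ ≡ side o′ × formula o₁ ≡ formula o′ ×
      ∀ R′ → Prv n (flat (premise o₁ R′)) → Prv n (flat (premise o′ R′))
    replace-nonprincipal (occurrence (here refl) left m) o₁≢o
      with Any.++⁻ (addAnte R) m in eq
    ... | inj₁ _ = contradiction refl o₁≢o
    ... | inj₂ k = refl , refl , sameSequent left k m
                     (flatS-erase-⊕ˡ (erase (side o) (sequent o) (member o)) R m eq)
    replace-nonprincipal (occurrence (here refl) right m) o₁≢o
      with Any.++⁻ (addSucc R) m in eq
    ... | inj₁ _ = contradiction refl o₁≢o
    ... | inj₂ k = refl , refl , sameSequent right k m
                     (flatS-erase-⊕ʳ (erase (side o) (sequent o) (member o)) R m eq)
    replace-nonprincipal o′@(occurrence (there i) s m) o₁≢o
      with Any.++⁻ (extra R) i in eq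
    ... | inj₁ _ = contradiction refl o₁≢o
    ... | inj₂ j = refl , refl , λ R′ d →
      let o₁ = occurrence (unerase (position o) j) s m in
      Prv-resp
        (H.↭-sym (H.↭-trans (flat-premise o′ R′) (expand-resp R′ S.↭-refl
          (H.prep (flatS-⊕ (erase (side o) (sequent o) (member o)) R)
            (H.↭-reflexive (trans (cong flat (++⁻-─ (extra R) i eq))
                                  (List.map-++ flatS (extra R) _)))))))
        (replace-other {L = L} {E = E} n replace
          (signed (addAnte R′) (addSucc R′)) (flat (extra R′))
          (H.↭-trans (map-─-unerase S.↭-setoid flatS (position o) j)
            (H.prep (flatS-erase (side o) (sequent o) (member o)) H.↭-refl))
          (Prv-resp (flat-premise o₁ R′) d))

  -- Rules of the calculus as instances

  rule⇒inst : ∀ {H s F Rs} → Rule H s F Rs →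
    ∃[ A ] ∃[ c ] ∃[ t ] F ≡ rpl A × Compound A × Rs ≡ inst s A c t
  rule⇒inst (→⇒ p _)     = _ , p , parameter 0 , refl , (λ ()) , refl
  rule⇒inst ⇒→           = _ , 0 , parameter 0 , refl , (λ ()) , refl
  rule⇒inst (∀⇒ p _ t _) = _ , p , t , refl , (λ ()) , refl
  rule⇒inst (⇒∀ a _)     = _ , a , parameter 0 , refl , (λ ()) , refl
  rule⇒inst (⇒∃ q _ t _) = _ , q , t , refl , (λ ()) , refl
  rule⇒inst (∃⇒ a _)     = _ , a , parameter 0 , refl , (λ ()) , refl

  inst⇒rule : ∀ {H} s A {c t} → Compound A → Closed t → FreshParam c H →
    FreshSemi (semi₁ c) H → FreshSemi (semi₀ c) H → Rule H s (rpl A) (inst s A c t)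
  inst⇒rule left  (A ⊃ B)   _ ct fp f₁ f₀ = →⇒ _ f₁
  inst⇒rule right (A ⊃ B)   _ ct fp f₁ f₀ = ⇒→
  inst⇒rule left  (all x A) _ ct fp f₁ f₀ = ∀⇒ _ f₁ _ ct
  inst⇒rule right (all x A) _ ct fp f₁ f₀ = ⇒∀ _ fp
  inst⇒rule left  (ex x A)  _ ct fp f₁ f₀ = ∃⇒ _ fp
  inst⇒rule right (ex x A)  _ ct fp f₁ f₀ = ⇒∃ _ f₀ _ ct
  inst⇒rule _ (pred _ _)    cA = contradiction pred cA
  inst⇒rule _ (const _ _ _) cA = contradiction const cA

  replace-rule : ∀ {H} (o : Occurrence H) {Rs} → Rule H (side o) (formula o) Rs →
    ∀ {R} → R ∈ Rs → ∀ {n K S G} → Prv n K →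
    K ≈ ((side o , formula o) ∷ S) ∷ G → Prv n (expand R S G)
  replace-rule (occurrence _ s _) r k d p with rule⇒inst r
  ... | A , c , t , refl , cA , refl = invert cA k d p

  Prv-premise : ∀ {H} (o : Occurrence H) {Rs} → Rule H (side o) (formula o) Rs →
    ∀ {R} → R ∈ Rs → ∀ {n} → Prv n (flat H) → Prv n (flat (premise o R))
  Prv-premise o r {R} k d = Prv-resp (H.↭-sym (flat-premise o R))
    (replace-rule o r k d (flat-occurrence o))

  Inv-nonprincipal : ∀ {H} (o : Occurrence H) {Rs} → Rule H (side o) (formula o) Rs →
    ∀ {R} → R ∈ Rs → ∀ {n} (o′ : Occurrence (premise o R)) →
    immediateDescendant o R o′ ≢ o → Inv n (immediateDescendant o R o′) → Inv n o′
  Inv-nonprincipal o r {R} k o′ o₁≢o (inv eq cA ct prems)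
    with replace-nonprincipal o R (replace-rule o r k) o′ o₁≢o
  ... | side≡ , formula≡ , transfer = inv (trans (sym formula≡) eq) cA ct
    λ c {R′} k′ → transfer R′
      (prems c (subst (λ s → R′ ∈ inst s _ c _) (sym side≡) k′))

  -- Agreement of axioms with valid signed hypersequents

  module _ (M : Interpretation) (ν : Valuation M) where

    total-++ : ∀ S T n → total M ν (S ++ T) n ≡ total M ν S n ℚ.+ total M ν T n
    total-++ []      T n = sym (ℚ.+-identityˡ _)
    total-++ (x ∷ S) T n =
      trans (cong (weight M ν x n ℚ.+_) (total-++ S T n))
            (sym (ℚ.+-assoc (weight M ν x n) _ _))

    value≡ : ∀ {F} (a : Atom F) → value M ν a ≡ valueOf M ν F
    value≡ pred  = refl
    value≡ const = refl
    value≡ semi₁ = refl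
    value≡ semi₀ = refl

    total-left : ∀ {Γ} (as : All Atom Γ) n →
      total M ν (map (left ,_) Γ) n ≡ ℚ.- ℝ.seq (multisetValue M ν as) n
    total-left []       n = refl
    total-left (a ∷ as) n = trans
      (cong₂ (λ v q → ℚ.- (ℝ.seq v n ℚ.- 1ℚ) ℚ.+ q)
             (sym (value≡ a)) (total-left as n))
      (sym (ℚ.neg-distrib-+ (ℝ.seq (value M ν a) n ℚ.- 1ℚ) _))

    total-right : ∀ {Δ} (as : All Atom Δ) n →
      total M ν (map (right ,_) Δ) n ≡ ℝ.seq (multisetValue M ν as) n
    total-right []       n = refl
    total-right (a ∷ as) n =
      cong₂ (λ v q → (ℝ.seq v n ℚ.- 1ℚ) ℚ.+ q) (sym (value≡ a)) (total-right as n)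

    total-signed : ∀ {Γ Δ} (as : All Atom Γ) (bs : All Atom Δ) n →
      ℝ.seq (multisetValue M ν bs Real.- multisetValue M ν as) n ≡
      total M ν (signed Γ Δ) n
    total-signed {Γ} as bs n = trans (ℚ.+-comm (ℝ.seq (multisetValue M ν bs) n) _)
      (sym (trans (total-++ (map (left ,_) Γ) _ n)
                  (cong₂ ℚ._+_ (total-left as n) (total-right bs n))))

    TrueAtomic⇒True : ∀ {S} → TrueAtomic M ν S → True M ν (flatS S)
    TrueAtomic⇒True (as , bs , nn) =
      All.++⁺ (All.map⁺ as) (All.map⁺ bs) ,
      Nonneg-resp (total-signed as bs) nn

    True⇒TrueAtomic : ∀ {S} → True M ν (flatS S) → TrueAtomic M ν S
    True⇒TrueAtomic {Γ ⇒ Δ} (atoms , nn) =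
      let as = All.map⁻ (All.++⁻ˡ (map (left ,_) Γ) atoms)
          bs = All.map⁻ (All.++⁻ʳ (map (left ,_) Γ) atoms)
      in as , bs , Nonneg-resp (λ n → sym (total-signed as bs n)) nn

  Axiom⇒Valid : ∀ {H} → Axiom H → Valid (flat H)
  Axiom⇒Valid ax M ν = Any.map⁺ (Any.map (TrueAtomic⇒True M ν) (ax M ν))

  Valid⇒Axiom : ∀ {H} → Valid (flat H) → Axiom H
  Valid⇒Axiom v M ν = Any.map (True⇒TrueAtomic M ν) (Any.map⁻ (v M ν))

  -- Renaming of function symbols and semipropositional variables

  FuncMap : Set
  FuncMap = ∀ n → Func n → Func n

  module _ (φ : FuncMap) where
    mutual
      renTerm : Term → Term
      renTerm (var x)       = var x
      renTerm (fn {n} f ts) = fn (φ n f) (renTerms ts)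

      renTerms : ∀ {n} → Vec Term n → Vec Term n
      renTerms []       = []
      renTerms (t ∷ ts) = renTerm t ∷ renTerms ts

    renRPL : RPL → RPL
    renRPL (pred P ts)         = pred P (renTerms ts)
    renRPL (const r 0≤r r≤1)   = const r 0≤r r≤1
    renRPL (A ⊃ B)             = renRPL A ⊃ renRPL B
    renRPL (all x A)           = all x (renRPL A)
    renRPL (ex x A)            = ex x (renRPL A)

    mutual
      renTerm-subst : ∀ x t s →
        renTerm (substTerm x t s) ≡ substTerm x (renTerm t) (renTerm s)
      renTerm-subst x t (var y) with x ℕ.≟ y
      ... | yes _ = refl
      ... | no  _ = refl
      renTerm-subst x t (fn f ts) = cong (fn _) (renTerms-subst x t ts)

      renTerms-subst : ∀ {n} x t (ss : Vec Term n) →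
        renTerms (substTerms x t ss) ≡ substTerms x (renTerm t) (renTerms ss)
      renTerms-subst x t []       = refl
      renTerms-subst x t (s ∷ ss) =
        cong₂ _∷_ (renTerm-subst x t s) (renTerms-subst x t ss)

    renRPL-subst : ∀ A t x → renRPL (A [ t / x ]) ≡ renRPL A [ renTerm t / x ]
    renRPL-subst (pred P ts)   t x = cong (pred P) (renTerms-subst x t ts)
    renRPL-subst (const _ _ _) t x = refl
    renRPL-subst (A ⊃ B)       t x = cong₂ _⊃_ (renRPL-subst A t x) (renRPL-subst B t x)
    renRPL-subst (all y A)     t x with x ℕ.≟ y
    ... | yes _ = refl
    ... | no  _ = cong (all y) (renRPL-subst A t x)
    renRPL-subst (ex y A)      t x with x ℕ.≟ y
    ... | yes _ = refl
    ... | no  _ = cong (ex y) (renRPL-subst A t x)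

    mutual
      renTerm-closed : ∀ {t} → Closed t → Closed (renTerm t)
      renTerm-closed (fn cs) = fn (renTerms-closed cs)

      renTerms-closed : ∀ {n} {ts : Vec Term n} →
                        Vec.All Closed ts → Vec.All Closed (renTerms ts)
      renTerms-closed Vec.[]       = Vec.[]
      renTerms-closed (c Vec.∷ cs) = renTerm-closed c Vec.∷ renTerms-closed cs

    renRPL-compound : ∀ {A} → Compound A → Compound (renRPL A)
    renRPL-compound {pred _ _}    cA _ = cA pred
    renRPL-compound {const _ _ _} cA _ = cA const
    renRPL-compound {_ ⊃ _}       cA ()
    renRPL-compound {all _ _}     cA ()
    renRPL-compound {ex _ _}      cA ()

  mutual
    renTerm-id : ∀ t → renTerm (λ _ f → f) t ≡ t
    renTerm-id (var x)   = refl
    renTerm-id (fn f ts) = cong (fn f) (renTerms-id ts)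

    renTerms-id : ∀ {n} (ts : Vec Term n) → renTerms (λ _ f → f) ts ≡ ts
    renTerms-id []       = refl
    renTerms-id (t ∷ ts) = cong₂ _∷_ (renTerm-id t) (renTerms-id ts)

  renRPL-id : ∀ A → renRPL (λ _ f → f) A ≡ A
  renRPL-id (pred P ts)   = cong (pred P) (renTerms-id ts)
  renRPL-id (const _ _ _) = refl
  renRPL-id (A ⊃ B)       = cong₂ _⊃_ (renRPL-id A) (renRPL-id B)
  renRPL-id (all x A)     = cong (all x) (renRPL-id A)
  renRPL-id (ex x A)      = cong (ex x) (renRPL-id A)

  record Renaming : Set where
    field
      func : FuncMap
      ren₁ : ℕ → ℕ
      ren₀ : ℕ → ℕ

  open Renaming

  identity : Renaming
  identity = record { func = λ _ f → f ; ren₁ = id ; ren₀ = id }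

  module _ (ρ : Renaming) where

    renFormula : Formula → Formula
    renFormula (rpl A)   = rpl (renRPL (func ρ) A)
    renFormula (semi₁ i) = semi₁ (ren₁ ρ i)
    renFormula (semi₀ i) = semi₀ (ren₀ ρ i)

    renSigned : Side × Formula → Side × Formula
    renSigned (s , F) = s , renFormula F

    renSeq : Seq → Seq
    renSeq = map renSigned

    renHyp : Hyp → Hyp
    renHyp = map renSeq

    renSequent : Sequent → Sequent
    renSequent (Γ ⇒ Δ) = map renFormula Γ ⇒ map renFormula Δ

    renReplacement : Replacement → Replacement
    renReplacement ⟨ Γ , Δ ∣ E ⟩ =
      ⟨ map renFormula Γ , map renFormula Δ ∣ map renSequent E ⟩

    renSeq-signed : ∀ Γ Δ →
      renSeq (signed Γ Δ) ≡ signed (map renFormula Γ) (map renFormula Δ)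
    renSeq-signed Γ Δ = trans (List.map-++ renSigned (map (left ,_) Γ) _)
      (cong₂ _++_ (trans (sym (List.map-∘ Γ)) (List.map-∘ Γ))
                  (trans (sym (List.map-∘ Δ)) (List.map-∘ Δ)))

    renHyp-flat : ∀ E → renHyp (flat E) ≡ flat (map renSequent E)
    renHyp-flat []            = refl
    renHyp-flat ((Γ ⇒ Δ) ∷ E) = cong₂ _∷_ (renSeq-signed Γ Δ) (renHyp-flat E)

    renHyp-expand : ∀ R S G →
      renHyp (expand R S G) ≡ expand (renReplacement R) (renSeq S) (renHyp G)
    renHyp-expand ⟨ Γ , Δ ∣ E ⟩ S G = cong₂ _∷_
      (trans (List.map-++ renSigned (signed Γ Δ) S)
             (cong (_++ renSeq S) (renSeq-signed Γ Δ)))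
      (trans (List.map-++ renSeq (flat E) G)
             (cong (_++ renHyp G) (renHyp-flat E)))

    renSeq-resp : ∀ {S T} → S ↭ T → renSeq S ↭ renSeq T
    renSeq-resp = SP.map⁺ (setoid _) (cong renSigned)

    renHyp-resp : ∀ {H K} → H ≈ K → renHyp H ≈ renHyp K
    renHyp-resp = HP.map⁺ S.↭-setoid renSeq-resp

    module _ (M : Interpretation) where
      open Interpretation M

      -- Renamings need not be injective: the renamed formula has under `M` the value that the
      -- original has when each symbol is read as its image.
      pullback : Interpretation
      pullback = record
        { Domain   = Domain
        ; element  = element
        ; funcᴹ    = λ {n} f → funcᴹ (func ρ n f)
        ; predᴹ    = predᴹ
        ; 0≤predᴹ  = 0≤predᴹ
        ; predᴹ≤1  = predᴹ≤1
        ; semi₀ᴹ   = semi₀ᴹ ∘ ren₀ ρ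
        ; 0≤semi₀ᴹ = 0≤semi₀ᴹ ∘ ren₀ ρ
        ; semi₁ᴹ   = semi₁ᴹ ∘ ren₁ ρ
        ; semi₁ᴹ≤1 = semi₁ᴹ≤1 ∘ ren₁ ρ
        }

      module _ (ν : Valuation M) where
        mutual
          termValue-pullback : ∀ t →
            termValue pullback ν t ≡ termValue M ν (renTerm (func ρ) t)
          termValue-pullback (var x)   = refl
          termValue-pullback (fn f ts) = cong (funcᴹ _) (termValues-pullback ts)

          termValues-pullback : ∀ {n} (ts : Vec Term n) →
            termValues pullback ν ts ≡ termValues M ν (renTerms (func ρ) ts)
          termValues-pullback []       = refl
          termValues-pullback (t ∷ ts) =
            cong₂ _∷_ (termValue-pullback t) (termValues-pullback ts)

        valueOf-pullback : ∀ F → valueOf pullback ν F ≡ valueOf M ν (renFormula F)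
        valueOf-pullback (rpl (pred P ts))   = cong (predᴹ P) (termValues-pullback ts)
        valueOf-pullback (rpl (const _ _ _)) = refl
        valueOf-pullback (rpl (_ ⊃ _))       = refl
        valueOf-pullback (rpl (all _ _))     = refl
        valueOf-pullback (rpl (ex _ _))      = refl
        valueOf-pullback (semi₁ _)           = refl
        valueOf-pullback (semi₀ _)           = refl

        total-pullback : ∀ S n → total pullback ν S n ≡ total M ν (renSeq S) n
        total-pullback []            n = refl
        total-pullback ((s , F) ∷ S) n = cong₂ ℚ._+_
          (cong (λ v → sign s (ℝ.seq (v Real.- 1ℝ) n)) (valueOf-pullback F))
          (total-pullback S n)

        atom-ren : ∀ {F} → Atom F → Atom (renFormula F)
        atom-ren pred  = pred
        atom-ren const = const
        atom-ren semi₁ = semi₁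
        atom-ren semi₀ = semi₀

        True-pullback : ∀ {S} → True pullback ν S → True M ν (renSeq S)
        True-pullback {S} (atoms , nn) =
          All.map⁺ (All.map atom-ren atoms) , Nonneg-resp (total-pullback S) nn

    Valid-ren : ∀ {H} → Valid H → Valid (renHyp H)
    Valid-ren v M ν = Any.map⁺ (Any.map (True-pullback M ν) (v (pullback M) ν))

  renFormula-id : ∀ F → renFormula identity F ≡ F
  renFormula-id (rpl A)   = cong rpl (renRPL-id A)
  renFormula-id (semi₁ i) = refl
  renFormula-id (semi₀ i) = refl

  renHyp-id : ∀ H → renHyp identity H ≡ H
  renHyp-id = map-≗id λ S → map-≗id (λ (s , F) → cong (s ,_) (renFormula-id F)) S
    where
    map-≗id : ∀ {A : Set} {f : A → A} → (∀ x → f x ≡ x) → ∀ xs → map f xs ≡ xs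
    map-≗id f≗id xs = trans (List.map-cong f≗id xs) (List.map-id xs)

  update : (ℕ → ℕ) → ℕ → ℕ → ℕ → ℕ
  update σ a b i with i ℕ.≟ a
  ... | yes _ = b
  ... | no  _ = σ i

  update-≡ : ∀ σ a b → update σ a b a ≡ b
  update-≡ σ a b with a ℕ.≟ a
  ... | yes _  = refl
  ... | no a≢a = contradiction refl a≢a

  update-≢ : ∀ σ {a} b {i} → a ≢ i → update σ a b i ≡ σ i
  update-≢ σ {a} b {i} a≢i with i ℕ.≟ a
  ... | yes i≡a = contradiction (sym i≡a) a≢i
  ... | no  _   = refl

  module _ (φ : FuncMap) (a b : ℕ) where

    -- Equality of nullary function symbols need not be decidable, hence the appeal to excluded
    -- middle.
    updateParam : FuncMap
    updateParam zero f with lowerEM em {f ≡ param a}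
    ... | yes _ = param b
    ... | no  _ = φ zero f
    updateParam (suc n) f = φ (suc n) f

    updateParam-≡ : updateParam 0 (param a) ≡ param b
    updateParam-≡ with lowerEM em {param a ≡ param a}
    ... | yes _  = refl
    ... | no a≢a = contradiction refl a≢a

    mutual
      updateParam-term : ∀ {t} → ¬ OccursInTerm a t →
                         renTerm updateParam t ≡ renTerm φ t
      updateParam-term {var x}              _   = refl
      updateParam-term {fn {zero} f []}     a∉t with lowerEM em {f ≡ param a}
      ... | yes refl = contradiction here a∉t
      ... | no  _    = refl
      updateParam-term {fn {suc n} f ts} a∉t = cong (fn _) (updateParam-terms (a∉t ∘ arg))

      updateParam-terms : ∀ {n} {ts : Vec Term n} → ¬ Vec.Any (OccursInTerm a) ts →
                          renTerms updateParam ts ≡ renTerms φ ts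
      updateParam-terms {ts = []}     _    = refl
      updateParam-terms {ts = t ∷ ts} a∉ts = cong₂ _∷_
        (updateParam-term (a∉ts ∘ Vec.here)) (updateParam-terms (a∉ts ∘ Vec.there))

    updateParam-RPL : ∀ {A} → ¬ OccursIn a A → renRPL updateParam A ≡ renRPL φ A
    updateParam-RPL {pred P ts}   a∉ = cong (pred P) (updateParam-terms (a∉ ∘ pred))
    updateParam-RPL {const _ _ _} a∉ = refl
    updateParam-RPL {A ⊃ B}       a∉ =
      cong₂ _⊃_ (updateParam-RPL (a∉ ∘ ⊃ˡ)) (updateParam-RPL (a∉ ∘ ⊃ʳ))
    updateParam-RPL {all x A}     a∉ = cong (all x) (updateParam-RPL (a∉ ∘ all))
    updateParam-RPL {ex x A}      a∉ = cong (ex x) (updateParam-RPL (a∉ ∘ ex))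

    updateParam-subst : ∀ {A} x → ¬ OccursIn a A →
      renRPL updateParam (A [ parameter a / x ]) ≡ renRPL φ A [ parameter b / x ]
    updateParam-subst {A} x a∉A = trans (renRPL-subst updateParam A (parameter a) x)
      (cong₂ (λ A f → A [ fn f [] / x ]) (updateParam-RPL a∉A) updateParam-≡)

  Agree : Renaming → Renaming → Hypersequent → Set
  Agree ρ ρ′ = All (AllMembers λ F → renFormula ρ′ F ≡ renFormula ρ F)

  Agree-refl : ∀ {ρ H} → Agree ρ ρ H
  Agree-refl = All.universal
    (λ _ → All.universal (λ _ → refl) _ , All.universal (λ _ → refl) _) _

  Agree-param : ∀ {a H} ρ b → FreshParam a H →
    Agree ρ (record ρ { func = updateParam (func ρ) a b }) H
  Agree-param {a} ρ b = All.map (Product.map (All.map agree) (All.map agree))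
    where
    agree : ∀ {F} → (∀ {A} → F ≡ rpl A → ¬ OccursIn a A) →
            renFormula (record ρ { func = updateParam (func ρ) a b }) F ≡ renFormula ρ F
    agree {rpl A}   fresh = cong rpl (updateParam-RPL (func ρ) a b (fresh refl))
    agree {semi₁ i} _     = refl
    agree {semi₀ i} _     = refl

  Agree-semi₁ : ∀ {p H} ρ b → FreshSemi (semi₁ p) H →
    Agree ρ (record ρ { ren₁ = update (ren₁ ρ) p b }) H
  Agree-semi₁ {p} ρ b = All.map (Product.map (All.map agree ∘ All.¬Any⇒All¬ _)
                                          (All.map agree ∘ All.¬Any⇒All¬ _))
    where
    agree : ∀ {F} → semi₁ p ≢ F →
            renFormula (record ρ { ren₁ = update (ren₁ ρ) p b }) F ≡ renFormula ρ F
    agree {rpl A}   _    = refl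
    agree {semi₁ i} p≢i  = cong semi₁ (update-≢ (ren₁ ρ) b (p≢i ∘ cong semi₁))
    agree {semi₀ i} _    = refl

  Agree-semi₀ : ∀ {p H} ρ b → FreshSemi (semi₀ p) H →
    Agree ρ (record ρ { ren₀ = update (ren₀ ρ) p b }) H
  Agree-semi₀ {p} ρ b = All.map (Product.map (All.map agree ∘ All.¬Any⇒All¬ _)
                                          (All.map agree ∘ All.¬Any⇒All¬ _))
    where
    agree : ∀ {F} → semi₀ p ≢ F →
            renFormula (record ρ { ren₀ = update (ren₀ ρ) p b }) F ≡ renFormula ρ F
    agree {rpl A}   _    = refl
    agree {semi₁ i} _    = refl
    agree {semi₀ i} p≢i  = cong semi₀ (update-≢ (ren₀ ρ) b (p≢i ∘ cong semi₀))

  module _ {ρ ρ′ : Renaming} where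

    agree-flatS : ∀ {S} → AllMembers (λ F → renFormula ρ′ F ≡ renFormula ρ F) S →
                  renSeq ρ′ (flatS S) ≡ renSeq ρ (flatS S)
    agree-flatS (es , es′) = List.map-cong-local
      (All.++⁺ (All.map⁺ (All.map (cong (left ,_)) es))
               (All.map⁺ (All.map (cong (right ,_)) es′)))

    agree-erase : ∀ {Q : Formula → Set} s {S F} (m : F ∈ members s S) →
                  AllMembers Q S → AllMembers Q (erase s S m)
    agree-erase left  m (qs , qs′) = All.─⁺ m qs , qs′
    agree-erase right m (qs , qs′) = qs , All.─⁺ m qs′

    agree-restS : ∀ {H} (o : Occurrence H) → Agree ρ ρ′ H →
                  renSeq ρ′ (restS o) ≡ renSeq ρ (restS o)
    agree-restS o ag =
      agree-flatS (agree-erase (side o) (member o) (All.lookup ag (position o)))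

    agree-restG : ∀ {H} (o : Occurrence H) → Agree ρ ρ′ H →
                  renHyp ρ′ (restG o) ≡ renHyp ρ (restG o)
    agree-restG o ag = List.map-cong-local
      (All.map⁺ (All.map agree-flatS (All.─⁺ (position o) ag)))

  lookup-member : ∀ {Q : Formula → Set} s {S F} → F ∈ members s S → AllMembers Q S → Q F
  lookup-member left  m (qs , _) = All.lookup qs m
  lookup-member right m (_ , qs) = All.lookup qs m

  -- The renaming `ρ′` is `ρ` redirected to send the fresh name of the rule to `c`. Freshness makes
  -- the two agree on the conclusion, so the renamed premise fits the renamed conclusion for every
  -- `c`.
  record RenamedRule {H} (ρ : Renaming) (o : Occurrence H)
                     (Rs : List Replacement) : Set where
    constructor renamedRule
    field
      {matrix}  : RPL
      isRPL     : formula o ≡ rpl matrix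
      compound  : Compound matrix
      {witness} : Term
      closed    : Closed witness
      premises  : ∀ c {R′} →
                  R′ ∈ inst (side o) (renRPL (func ρ) matrix) c witness →
                  ∃[ ρ′ ] ∃[ R ] R ∈ Rs × R′ ≡ renReplacement ρ′ R × Agree ρ ρ′ H

  renameRule : ∀ {H} (o : Occurrence H) {Rs} → Rule H (side o) (formula o) Rs →
               ∀ ρ → RenamedRule ρ o Rs
  renameRule (occurrence _ _ _) (→⇒ {A} {B} p fresh) ρ =
    renamedRule refl (λ ()) {parameter 0} (fn Vec.[]) λ { c (here refl) →
      _ , _ , here refl ,
      cong (λ i → ⟨ [ semi₁ i ] , [] ∣ [ [ rpl (renRPL (func ρ) B) ] ⇒
                                         semi₁ i ∷ rpl (renRPL (func ρ) A) ∷ [] ] ⟩)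
           (sym (update-≡ (ren₁ ρ) p c)) ,
      Agree-semi₁ ρ c fresh }
  renameRule (occurrence _ _ _) ⇒→ ρ =
    renamedRule refl (λ ()) {parameter 0} (fn Vec.[])
      λ { c (here refl)         → ρ , _ , here refl , refl , Agree-refl
        ; c (there (here refl)) → ρ , _ , there (here refl) , refl , Agree-refl }
  renameRule (occurrence _ _ _) (∀⇒ {x} {A} p fresh t ct) ρ =
    renamedRule refl (λ ()) (renTerm-closed (func ρ) ct) λ { c (here refl) →
      _ , _ , here refl ,
      cong₂ (λ i B → ⟨ [ semi₁ i ] , []
                     ∣ ([ rpl (all x (renRPL (func ρ) A)) ] ⇒ [ semi₁ i ])
                     ∷ ([ rpl B ] ⇒ [ semi₁ i ]) ∷ [] ⟩)
            (sym (update-≡ (ren₁ ρ) p c)) (sym (renRPL-subst (func ρ) A t x)) ,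
      Agree-semi₁ ρ c fresh }
  renameRule (occurrence _ _ _) (⇒∃ {x} {A} p fresh t ct) ρ =
    renamedRule refl (λ ()) (renTerm-closed (func ρ) ct) λ { c (here refl) →
      _ , _ , here refl ,
      cong₂ (λ i B → ⟨ [] , [ semi₀ i ]
                     ∣ ([ semi₀ i ] ⇒ [ rpl (ex x (renRPL (func ρ) A)) ])
                     ∷ ([ semi₀ i ] ⇒ [ rpl B ]) ∷ [] ⟩)
            (sym (update-≡ (ren₀ ρ) p c)) (sym (renRPL-subst (func ρ) A t x)) ,
      Agree-semi₀ ρ c fresh }
  renameRule (occurrence i s m) (⇒∀ {x} {A} a fresh) ρ =
    renamedRule refl (λ ()) {parameter 0} (fn Vec.[]) λ { c (here refl) →
      _ , _ , here refl ,
      cong (λ B → ⟨ [] , [ rpl B ] ∣ [] ⟩)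
           (sym (updateParam-subst (func ρ) a c x (a∉ ∘ all))) ,
      Agree-param ρ c fresh }
    where a∉ = lookup-member s m (All.lookup fresh i) refl
  renameRule (occurrence i s m) (∃⇒ {x} {A} a fresh) ρ =
    renamedRule refl (λ ()) {parameter 0} (fn Vec.[]) λ { c (here refl) →
      _ , _ , here refl ,
      cong (λ B → ⟨ [ rpl B ] , [] ∣ [] ⟩)
           (sym (updateParam-subst (func ρ) a c x (a∉ ∘ ex))) ,
      Agree-param ρ c fresh }
    where a∉ = lookup-member s m (All.lookup fresh i) refl

  mutual
    -- Quantifying over all renamings carries the induction, since a rule needs its premise under
    -- `ρ` changed at its fresh name. The height is chosen before `ρ` because the premises for
    -- infinitely many names must share one bound.
    Tree⇒Prv : ∀ {H} (D : Tree H) → IsProof D → ∃[ n ] ∀ ρ → Prv n (renHyp ρ (flat H))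
    Tree⇒Prv leaf proof = 0 , λ ρ → valid (Valid-ren ρ (Axiom⇒Valid (proof _ here)))
    Tree⇒Prv {H} (node o r Ds) proof =
      let n , prems = Trees⇒Prv o Ds λ k K ℓ → proof K (there k ℓ) in
      suc n , λ ρ → infer-renamed o n prems ρ (renameRule o r ρ)

    Trees⇒Prv : ∀ {H} (o : Occurrence H) {Rs} (Ds : All (λ R → Tree (premise o R)) Rs) →
      (∀ {R} (k : R ∈ Rs) → IsProof (All.lookup Ds k)) →
      ∃[ n ] ∀ {R} → R ∈ Rs → ∀ ρ → Prv n (renHyp ρ (flat (premise o R)))
    Trees⇒Prv o []       proofs = 0 , λ ()
    Trees⇒Prv o (D ∷ Ds) proofs =
      let m , p  = Tree⇒Prv D (proofs (here refl))
          n , ps = Trees⇒Prv o Ds (λ k → proofs (there k))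
      in m ⊔ n , λ { (here refl) ρ → Prv-mono (ℕ.m≤m⊔n m n) (p ρ)
                   ; (there k)   ρ → Prv-mono (ℕ.m≤n⊔m m n) (ps k ρ) }

    infer-renamed : ∀ {H} (o : Occurrence H) {Rs} n →
      (∀ {R} → R ∈ Rs → ∀ ρ → Prv n (renHyp ρ (flat (premise o R)))) →
      ∀ ρ → RenamedRule ρ o Rs → Prv (suc n) (renHyp ρ (flat H))
    infer-renamed o n prems ρ (renamedRule {A} isRPL cA ct ps) =
      infer (side o) (renRPL (func ρ) A) (renRPL-compound (func ρ) cA) ct
        (subst (λ F → renHyp ρ (flat _) ≈
                      ((side o , renFormula ρ F) ∷ renSeq ρ (restS o)) ∷ renHyp ρ (restG o))
          isRPL (renHyp-resp ρ (flat-occurrence o)))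
        λ c k → premise-of (ps c k)
      where
      premise-of : ∀ {R′} →
                   (∃[ ρ′ ] ∃[ R ] R ∈ _ × R′ ≡ renReplacement ρ′ R × Agree ρ ρ′ _) →
                   Prv n (expand R′ (renSeq ρ (restS o)) (renHyp ρ (restG o)))
      premise-of (ρ′ , R , k , refl , ag) = subst (Prv n)
        (trans (renHyp-expand ρ′ R (restS o) (restG o))
          (cong₂ (expand (renReplacement ρ′ R)) (agree-restS o ag) (agree-restG o ag)))
        (Prv-resp (renHyp-resp ρ′ (flat-premise o R)) (prems k ρ′))

  Provable⇒Prv : ∀ {H} → Provable H → ∃[ n ] Prv n (flat H)
  Provable⇒Prv {H} (D , proof) =
    let n , p = Tree⇒Prv D proof in n , subst (Prv n) (renHyp-id (flat H)) (p identity)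

  -- Fresh names

  mutual
    termBound : ∀ t → ∃[ N ] ∀ {a} → N ℕ.≤ a → ¬ OccursInTerm a t
    termBound (var x) = 0 , λ _ ()
    -- A nullary symbol may or may not be a parameter. If it is, injectivity makes its index unique,
    -- so all larger indices avoid it.
    termBound (fn {zero} f []) with lowerEM em {∃[ b ] f ≡ param b}
    ... | yes (b , f≡b) = suc b , λ b<a occ → ℕ.<⇒≢ b<a (sym (isParam f≡b occ))
      where
      isParam : ∀ {f a b} → f ≡ param b → OccursInTerm a (fn f []) → a ≡ b
      isParam f≡b here = param-injective f≡b
    ... | no ¬param = 0 , λ _ occ → notParam ¬param occ
      where
      notParam : ∀ {f a} → ¬ (∃[ b ] f ≡ param b) → ¬ OccursInTerm a (fn f [])
      notParam ¬param here = ¬param (_ , refl)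
    termBound (fn {suc n} f ts) =
      let N , p = termsBound ts in N , λ { N≤a (arg occ) → p N≤a occ }

    termsBound : ∀ {n} (ts : Vec Term n) →
                 ∃[ N ] ∀ {a} → N ℕ.≤ a → ¬ Vec.Any (OccursInTerm a) ts
    termsBound []       = 0 , λ _ ()
    termsBound (t ∷ ts) =
      let M , p = termBound t ; N , q = termsBound ts in
      M ⊔ N , λ { le (Vec.here occ)  → p (ℕ.m⊔n≤o⇒m≤o M N le) occ
                ; le (Vec.there occ) → q (ℕ.m⊔n≤o⇒n≤o M N le) occ }

  paramBound : ∀ A → ∃[ N ] ∀ {a} → N ℕ.≤ a → ¬ OccursIn a A
  paramBound (pred P ts) =
    let N , p = termsBound ts in N , λ { N≤a (pred occ) → p N≤a occ }
  paramBound (const _ _ _) = 0 , λ _ ()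
  paramBound (A ⊃ B) =
    let M , p = paramBound A ; N , q = paramBound B in
    M ⊔ N , λ { le (⊃ˡ occ) → p (ℕ.m⊔n≤o⇒m≤o M N le) occ
              ; le (⊃ʳ occ) → q (ℕ.m⊔n≤o⇒n≤o M N le) occ }
  paramBound (all x A) =
    let N , p = paramBound A in N , λ { N≤a (all occ) → p N≤a occ }
  paramBound (ex x A) =
    let N , p = paramBound A in N , λ { N≤a (ex occ) → p N≤a occ }

  Fresh : ℕ → Formula → Set
  Fresh c F = (∀ {A} → F ≡ rpl A → ¬ OccursIn c A) × semi₁ c ≢ F × semi₀ c ≢ F

  Bound : ∀ {A : Set} → (ℕ → A → Set) → A → Set
  Bound P x = ∃[ N ] ∀ {c} → N ℕ.≤ c → P c x

  formulaBound : ∀ F → Bound Fresh F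
  formulaBound (rpl A) =
    let N , p = paramBound A in N , λ N≤c → (λ { refl → p N≤c }) , (λ ()) , (λ ())
  formulaBound (semi₁ i) =
    suc i , λ i<c → (λ ()) , (λ { refl → ℕ.<-irrefl refl i<c }) , (λ ())
  formulaBound (semi₀ i) =
    suc i , λ i<c → (λ ()) , (λ ()) , (λ { refl → ℕ.<-irrefl refl i<c })

  allBound : ∀ {A : Set} {P : ℕ → A → Set} → (∀ x → Bound P x) →
             ∀ xs → Bound (λ c → All (P c)) xs
  allBound b []       = 0 , λ _ → []
  allBound b (x ∷ xs) =
    let M , p = b x ; N , q = allBound b xs in
    M ⊔ N , λ le → p (ℕ.m⊔n≤o⇒m≤o M N le) ∷ q (ℕ.m⊔n≤o⇒n≤o M N le)

  sequentBound : ∀ S → Bound (λ c → AllMembers (Fresh c)) S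
  sequentBound (Γ ⇒ Δ) =
    let M , p = allBound formulaBound Γ ; N , q = allBound formulaBound Δ in
    M ⊔ N , λ le → p (ℕ.m⊔n≤o⇒m≤o M N le) , q (ℕ.m⊔n≤o⇒n≤o M N le)

  freshName : ∀ H → ∃[ c ]
    FreshParam c H × FreshSemi (semi₁ c) H × FreshSemi (semi₀ c) H
  freshName H =
    let c , p = allBound sequentBound H
        q     = p ℕ.≤-refl
    in c , All.map (Product.map (All.map proj₁) (All.map proj₁)) q
         , All.map (Product.map (notMember (proj₁ ∘ proj₂)) (notMember (proj₁ ∘ proj₂))) q
         , All.map (Product.map (notMember (proj₂ ∘ proj₂)) (notMember (proj₂ ∘ proj₂))) q
    where
    notMember : ∀ {c F Γ} → (∀ {G} → Fresh c G → F ≢ G) → All (Fresh c) Γ → F ∉ Γ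
    notMember f fs = All.All¬⇒¬Any (All.map f fs)

  -- Strategic proof search

  least : ∀ (P : ℕ → Set₁) n → P n → ∃[ m ] P m × ∀ k → P k → m ℕ.≤ k
  least P n p with em {P 0}
  ... | yes p₀ = 0 , p₀ , λ _ _ → ℕ.z≤n
  least P zero    p | no ¬p₀ = contradiction p ¬p₀
  least P (suc n) p | no ¬p₀ =
    let m , q , min = least (λ k → P (suc k)) n p in
    suc m , q , λ { zero p₀ → contradiction p₀ ¬p₀ ; (suc k) pk → ℕ.s≤s (min k pk) }

  -- A single choice must serve all n at once, since the search does not know
  -- the height at which o will be used; the shortest proof provides it.
  Optimal : ∀ {K} (o : Occurrence K) → List Replacement → Set₁
  Optimal o Rs = ∀ {n} → Inv n o → ∀ {R} → R ∈ Rs → Prv n (flat (premise o R))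

  compound : ∀ {F} → ¬ Atom F → ∃[ A ] F ≡ rpl A × Compound A
  compound {rpl A}   ¬atom = A , refl , ¬atom
  compound {semi₁ i} ¬atom = contradiction semi₁ ¬atom
  compound {semi₀ i} ¬atom = contradiction semi₀ ¬atom

  instRule : ∀ {K} (o : Occurrence K) {A t} →
             formula o ≡ rpl A → Compound A → Closed t →
             ∃[ c ] Rule K (side o) (formula o) (inst (side o) A c t)
  instRule {K} o {A} eq cA ct =
    let c , fp , f₁ , f₀ = freshName K in
    c , subst (λ F → Rule K (side o) F _) (sym eq)
              (inst⇒rule (side o) A cA ct fp f₁ f₀)

  choose : ∀ {K} (o : Occurrence K) → ¬ Atom (formula o) →
           ∃[ Rs ] Rule K (side o) (formula o) Rs × Optimal o Rs
  choose o ¬atom with em {∃[ n ] Inv n o}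
  ... | yes (n , i) =
    let m , inv eq cA ct prems , min = least (λ k → Inv k o) n i
        c , r = instRule o eq cA ct
    in _ , r , λ j k → Prv-mono (min _ j) (prems c k)
  -- No proof ends at `o`, so optimality is vacuous and any closed term will do.
  ... | no ¬inv =
    let A , eq , cA = compound ¬atom
        c , r = instRule o {t = parameter 0} eq cA (fn Vec.[])
    in _ , r , λ j → contradiction (_ , j) ¬inv

  -- Extension of search trees and their nodes

  data _⊑_ {H} : Tree H → Tree H → Set where
    leaf : ∀ {D} → leaf ⊑ D
    node : ∀ {o Rs} {r : Rule H (side o) (formula o) Rs} {Ds Es} →
           (∀ {R} (k : R ∈ Rs) → All.lookup Ds k ⊑ All.lookup Es k) →
           node o r Ds ⊑ node o r Es

  ⊑-refl : ∀ {H} (D : Tree H) → D ⊑ D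
  ⊑-refl-lookup : ∀ {H} {o : Occurrence H} {Rs}
                  (Ds : All (λ R → Tree (premise o R)) Rs) →
                  ∀ {R} (k : R ∈ Rs) → All.lookup Ds k ⊑ All.lookup Ds k
  ⊑-refl leaf          = leaf
  ⊑-refl (node o r Ds) = node (⊑-refl-lookup {o = o} Ds)
  ⊑-refl-lookup (D ∷ Ds) (here refl) = ⊑-refl D
  ⊑-refl-lookup {o = o} (D ∷ Ds) (there k) = ⊑-refl-lookup {o = o} Ds k

  ⊑-trans : ∀ {H} {D E F : Tree H} → D ⊑ E → E ⊑ F → D ⊑ F
  ⊑-trans leaf     _        = leaf
  ⊑-trans (node f) (node g) = node λ k → ⊑-trans (f k) (g k)

  ⊑-extend : ∀ {H K} (D : Tree H) (ℓ : Leaf D K) o {Rs}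
             (r : Rule K (side o) (formula o) Rs) → D ⊑ extend D ℓ o r
  ⊑-extend leaf           here        o r = leaf
  ⊑-extend (node o′ r′ Ds) (there k ℓ) o r = node
    (lookup-≔ (λ k E → All.lookup Ds k ⊑ E) Ds k
      (⊑-extend (All.lookup Ds k) ℓ o r) (⊑-refl-lookup {o = o′} Ds))

  -- Validity is provability at height 0 and inversion preserves height, so all premises over an
  -- axiom are axioms. A finished subproof is thus not spoiled when the tactic expands it further.
  Axiom-leaf : ∀ {H K} {D : Tree H} → Axiom H → Leaf D K → Axiom K
  Axiom-leaf ax here = ax
  Axiom-leaf ax (there {o = o} {r = r} k ℓ)
    with Prv-premise o r k (valid {n = 0} (Axiom⇒Valid ax))
  ... | valid v = Axiom-leaf (Valid⇒Axiom v) ℓ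

  IsProof-⊑ : ∀ {H} {D E : Tree H} → D ⊑ E → IsProof D → IsProof E
  IsProof-⊑ leaf     proof K ℓ           = Axiom-leaf (proof _ here) ℓ
  IsProof-⊑ (node f) proof K (there k ℓ) =
    IsProof-⊑ (f k) (λ K ℓ → proof K (there k ℓ)) K ℓ

  data At : ∀ {H K} → Tree H → Path H K → Tree K → Set where
    here  : ∀ {H} {D : Tree H} → At D ε D
    there : ∀ {H K o Rs} {r : Rule H (side o) (formula o) Rs} {Ds R}
            {k : R ∈ Rs} {π : Path (premise o R) K} {E} →
            At (All.lookup Ds k) π E → At (node o r Ds) (step o r k ◅ π) E

  ∈ᵀ⇒At : ∀ {H K} {D : Tree H} {π : Path H K} → π ∈ᵀ D → ∃[ E ] At D π E
  ∈ᵀ⇒At root      = _ , here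
  ∈ᵀ⇒At (child i) = let E , a = ∈ᵀ⇒At i in E , there a

  At⇒∈ᵀ : ∀ {H K} {D : Tree H} {π : Path H K} {E} → At D π E → π ∈ᵀ D
  At⇒∈ᵀ here      = root
  At⇒∈ᵀ (there a) = child (At⇒∈ᵀ a)

  At-⊑ : ∀ {H K} {D D′ : Tree H} {π : Path H K} {E} → D ⊑ D′ → At D π E →
         ∃[ E′ ] At D′ π E′ × E ⊑ E′
  At-⊑ le       here                 = _ , here , le
  At-⊑ (node f) (there {k = k} a) =
    let E′ , a′ , le = At-⊑ (f k) a in E′ , there a′ , le

  At-◅◅ : ∀ {H K L} {D : Tree H} {π : Path H K} {E} {ρ : Path K L} {F} →
          At D π E → At E ρ F → At D (π ◅◅ ρ) F
  At-◅◅ here      b = b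
  At-◅◅ (there a) b = there (At-◅◅ a b)

  At-expanded : ∀ {H K L M} {D : Tree H} (π : Path H K) {s : Step K L}
    {ρ : Path L M} {E} →
    At D (π ◅◅ s ◅ ρ) E →
    ∃[ o ] ∃[ Rs ] Σ (Rule K (side o) (formula o) Rs) λ r → ∃[ Ds ] At D π (node o r Ds)
  At-expanded ε       (there a) = _ , _ , _ , _ , here
  At-expanded (_ ◅ π) (there a) =
    let o , Rs , r , Ds , b = At-expanded π a in o , Rs , r , Ds , there b

  -- The unifier cannot invert the index premise o R of a step; projecting the
  -- components of a path makes equations between paths usable.
  uncons : ∀ {H} → Σ Hypersequent (Path H) →
    Maybe (Σ (Occurrence H) λ o → Σ (List Replacement) λ Rs →
           Σ (Rule H (side o) (formula o) Rs) λ _ →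
           Σ Replacement λ R → R ∈ Rs × Σ Hypersequent (Path (premise o R)))
  uncons (_ , ε)              = nothing
  uncons (K , step o r k ◅ π) = just (o , _ , r , _ , k , K , π)

  At-functional′ : ∀ {H K K′} {D : Tree H} {π : Path H K} {π′ : Path H K′} {E E′} →
    At D π E → At D π′ E′ → _≡_ {A = Σ Hypersequent (Path H)} (K , π) (K′ , π′) →
    _≡_ {A = Σ Hypersequent Tree} (K , E) (K′ , E′)
  At-functional′ here      here       eq = refl
  At-functional′ here      (there b)  eq = contradiction (cong uncons eq) λ ()
  At-functional′ (there a) here       eq = contradiction (cong uncons eq) λ ()
  At-functional′ (there a) (there b)  eq with cong uncons eq
  ... | refl = At-functional′ a b refl

  At-functional : ∀ {H K} {D : Tree H} {π : Path H K} {E E′} →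
                  At D π E → At D π E′ → E ≡ E′
  At-functional a b with At-functional′ a b refl
  ... | refl = refl

  data Strategic {H} : Tree H → Set₁ where
    leaf : Strategic leaf
    node : ∀ {o Rs} {r : Rule H (side o) (formula o) Rs} {Ds} → Optimal o Rs →
           (∀ {R} (k : R ∈ Rs) → Strategic (All.lookup Ds k)) → Strategic (node o r Ds)

  Strategic-extend : ∀ {H K} {D : Tree H} (ℓ : Leaf D K) o {Rs}
    (r : Rule K (side o) (formula o) Rs) → Optimal o Rs → Strategic D →
    Strategic (extend D ℓ o r)
  Strategic-extend here o r opt leaf = node opt λ k →
    subst Strategic (sym (lookup-universal (λ _ → leaf) k)) leaf
  Strategic-extend (there {Ds = Ds} k ℓ) o r opt (node opt′ f) = node opt′
    (lookup-≔ (λ _ → Strategic) Ds k (Strategic-extend ℓ o r opt (f k)) f)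

  StepOptimal : ∀ {K L} → Step K L → Set₁
  StepOptimal (step o {Rs} _ _) = Optimal o Rs

  Strategic-step : ∀ {H K L} {D : Tree H} (π : Path H K) (s : Step K L) {E} →
    Strategic D → At D (π ◅◅ s ◅ ε) E → StepOptimal s
  Strategic-step ε       _ (node opt _) (there a) = opt
  Strategic-step (_ ◅ π) s (node _ f)   (there {k = k} a) = Strategic-step π s (f k) a

  -- The run with optimal choices

  module _ (𝔱 : Tactic) where

    advance : ∀ {H} (D : Tree H) →
              ∃[ E ] Result 𝔱 D E × D ⊑ E × (Strategic D → Strategic E)
    advance D with 𝔱 _ D in eq
    ... | inj₁ _ = D , stop eq , ⊑-refl D , λ st → st
    ... | inj₂ g =
      let Rs , r , opt = choose (selected g) (nonAtomic g) in
      _ , apply eq r , ⊑-extend D (atLeaf g) (selected g) r ,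
      Strategic-extend (atLeaf g) (selected g) r opt

    module _ (H : Hypersequent) where

      stage : ℕ → Tree H
      stage zero    = leaf
      stage (suc n) = proj₁ (advance (stage n))

      run : Run 𝔱 H
      run = record { stage   = stage
                   ; initial = refl
                   ; next    = λ n → proj₁ (proj₂ (advance (stage n))) }

      constructible : ∀ n → Constructible 𝔱 (stage n)
      constructible zero    = ε
      constructible (suc n) = constructible n ◅◅ (Run.next run n ◅ ε)

      strategic : ∀ n → Strategic (stage n)
      strategic zero    = leaf
      strategic (suc n) = proj₂ (proj₂ (proj₂ (advance (stage n)))) (strategic n)

      stage-+ : ∀ k {n} → stage n ⊑ stage (k ℕ.+ n)
      stage-+ zero    {n} = ⊑-refl (stage n)
      stage-+ (suc k) {n} = ⊑-trans (stage-+ k)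
        (proj₁ (proj₂ (proj₂ (advance (stage (k ℕ.+ n))))))

      stage-mono : ∀ {m n} → m ℕ.≤ n → stage m ⊑ stage n
      stage-mono {m} {n} m≤n =
        subst (λ k → stage m ⊑ stage k) (ℕ.m∸n+n≡m m≤n) (stage-+ (n ℕ.∸ m))

      -- Unsolved nodes and the branch through them

      Solved : ∀ {K} → Path H K → ℕ → Set₁
      Solved π n = ∃[ D ] At (stage n) π D × IsProof D

      Solved-mono : ∀ {K} (π : Path H K) {m n} → m ℕ.≤ n → Solved π m → Solved π n
      Solved-mono π m≤n (D , a , proof) =
        let E , b , le = At-⊑ (stage-mono m≤n) a in E , b , IsProof-⊑ le proof

      Bad : ∀ {K} → Path H K → Set₁
      Bad π = ∀ n → ¬ Solved π n

      OpenChild : ∀ {K} → Path H K → Σ Hypersequent (Step K) → Set₁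
      OpenChild π (_ , s) = Limit run (π ◅◅ s ◅ ε) × Bad (π ◅◅ s ◅ ε)

      -- If every child were solved at some stage, one stage would solve all of the finitely many
      -- children, and with them the node itself.
      kőnig : ∀ {K n o Rs} {r : Rule K (side o) (formula o) Rs} {Ds} (π : Path H K) →
              Bad π → At (stage n) π (node o r Ds) → ∃[ s ] OpenChild π s
      kőnig {n = n} {o} {Rs} {r} {Ds} π bad a with em {∃[ s ] OpenChild π s}
      ... | yes open′ = open′
      ... | no ¬open  = contradiction solved (bad (N ⊔ n))
        where
        path : ∀ {R} → R ∈ Rs → Path H (premise o R)
        path k = π ◅◅ step o r k ◅ ε

        solvedChild : ∀ {R} (k : R ∈ Rs) → ∃[ m ] Solved (path k) m
        solvedChild k with em {∃[ m ] Solved (path k) m}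
        ... | yes s = s
        ... | no ¬s = contradiction
          (_ , (n , At⇒∈ᵀ (At-◅◅ a (there here))) , λ m s → ¬s (m , s)) ¬open

        bound = uniformBound (λ k → Solved (path k)) (λ k → Solved-mono (path k))
                             solvedChild
        N = proj₁ bound

        -- Stage `N` serves all children, and at stage `n` the node is already expanded.
        solved : Solved π (N ⊔ n)
        solved with At-⊑ (stage-mono (ℕ.m≤n⊔m N n)) a
        ... | node _ _ Es , b , node _ = _ , b , λ where
          K (there k ℓ) →
            let D , c , proof = Solved-mono (path k) (ℕ.m≤m⊔n N n) (proj₂ bound k) in
            subst IsProof (At-functional c (At-◅◅ b (there here))) proof K ℓ

      -- A `NodeSet` takes values in `Set`, whereas openness lives in `Set₁`. Recording the choice
      -- as a value turns membership in the branch into equations, which are small, and makes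
      -- successors unique.
      chosen : ∀ {K} → Path H K → Maybe (Σ Hypersequent (Step K))
      chosen π with em {∃[ s ] OpenChild π s}
      ... | yes (s , _) = just s
      ... | no  _       = nothing

      chosen-open : ∀ {K} (π : Path H K) {s} → chosen π ≡ just s → OpenChild π s
      chosen-open π eq with em {∃[ s ] OpenChild π s}
      chosen-open π refl | yes (_ , open′) = open′

      open⇒chosen : ∀ {K} (π : Path H K) →
                    ∃[ s ] OpenChild π s → ∃[ s ] chosen π ≡ just s
      open⇒chosen π open′ with em {∃[ s ] OpenChild π s}
      ... | yes (s , _) = s , refl
      ... | no ¬open    = contradiction open′ ¬open

      Follows : ∀ {K L} → Path H K → Path K L → Set
      Follows π ε       = ⊤
      Follows π (s ◅ ρ) = chosen π ≡ just (_ , s) × Follows (π ◅◅ s ◅ ε) ρ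

      Branch : NodeSet H
      Branch π = Follows ε π

      OpenNode : ∀ {K} → Path H K → Set₁
      OpenNode π = Limit run π × Bad π

      Follows-open : ∀ {K L} (π : Path H K) (ρ : Path K L) →
                     OpenNode π → Follows π ρ → OpenNode (π ◅◅ ρ)
      Follows-open π ε       open′ _        = subst OpenNode (sym (◅◅-ε π)) open′
        where
        ◅◅-ε : ∀ {K L} (π : Path K L) → π ◅◅ ε ≡ π
        ◅◅-ε ε       = refl
        ◅◅-ε (s ◅ π) = cong (s ◅_) (◅◅-ε π)
      Follows-open π (s ◅ ρ) open′ (eq , f) = subst OpenNode (◅◅-assoc π (s ◅ ε) ρ)
        (Follows-open (π ◅◅ s ◅ ε) ρ (chosen-open π eq) f)

      Follows-prefix : ∀ {K L M} (π : Path H K) (ρ : Path K L) {τ : Path L M} →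
                       Follows π (ρ ◅◅ τ) → Follows π ρ
      Follows-prefix π ε       _        = tt
      Follows-prefix π (s ◅ ρ) (eq , f) = eq , Follows-prefix (π ◅◅ s ◅ ε) ρ f

      Follows-chain : ∀ {K L M} (π : Path H K) (ρ : Path K L) (τ : Path K M) →
                      Follows π ρ → Follows π τ → Comparable ρ τ
      Follows-chain π ε       τ       _        _         = inj₁ (τ , refl)
      Follows-chain π (s ◅ ρ) ε       _        _         = inj₂ (s ◅ ρ , refl)
      Follows-chain π (s ◅ ρ) (s′ ◅ τ) (eq , f) (eq′ , g) with trans (sym eq) eq′
      ... | refl with Follows-chain (π ◅◅ s ◅ ε) ρ τ f g
      ...   | inj₁ (σ , refl) = inj₁ (σ , refl)
      ...   | inj₂ (σ , refl) = inj₂ (σ , refl)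

      headStep : ∀ {K L} → Path K L → Maybe (Σ Hypersequent (Step K))
      headStep ε       = nothing
      headStep (s ◅ _) = just (_ , s)

      Comparable-head : ∀ {K L L′ M M′} {s : Step K L} {s′ : Step K L′}
        {ρ : Path L M} {ρ′ : Path L′ M′} → Comparable (s ◅ ρ) (s′ ◅ ρ′) →
        just (L , s) ≡ just (L′ , s′)
      Comparable-head (inj₁ (_ , eq)) = cong headStep eq
      Comparable-head (inj₂ (_ , eq)) = sym (cong headStep eq)

      Comparable-tail : ∀ {K L M M′} (s : Step K L) {ρ : Path L M} {ρ′ : Path L M′} →
        Comparable (s ◅ ρ) (s ◅ ρ′) → Comparable ρ ρ′
      Comparable-tail s (inj₁ (σ , refl)) = inj₁ (σ , refl)
      Comparable-tail s (inj₂ (σ , refl)) = inj₂ (σ , refl)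

      -- A path that continues past `π` shows that `π` has been expanded, so an open child is chosen
      -- there. Comparability with that child forces the next step of the path to lead to it.
      Follows-maximal : ∀ {K L} (π : Path H K) (ρ : Path K L) →
        Bad π → Limit run (π ◅◅ ρ) →
        (∀ {M} {τ : Path K M} → Follows π τ → Comparable ρ τ) → Follows π ρ
      Follows-maximal π ε       bad _         comparable = tt
      Follows-maximal π (s ◅ ρ) bad (n , i) comparable
        with At-expanded π (proj₂ (∈ᵀ⇒At i))
      ... | o , Rs , r , Ds , a with open⇒chosen π (kőnig {n = n} π bad a)
      ...   | (_ , s′) , eq with Comparable-head (comparable {τ = s′ ◅ ε} (eq , tt))
      ...     | refl = eq , Follows-maximal (π ◅◅ s ◅ ε) ρ (proj₂ (chosen-open π eq))
        (n , subst (_∈ᵀ stage n) (sym (◅◅-assoc π (s ◅ ε) ρ)) i)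
        λ f → Comparable-tail s (comparable (eq , f))

      -- Descent of proof height along the branch

      module _ (unsolved : ∀ n → ¬ IsProof (stage n)) where

        rootOpen : OpenNode {H} ε
        rootOpen = (0 , root) , λ { n (_ , here , proof) → unsolved n proof }

        isBranch : IsBranch (Limit run) Branch
        isBranch = record
          { within  = λ {_} {π} f → proj₁ (Follows-open ε π rootOpen f)
          ; chain   = λ {_} {_} {π} {π′} → Follows-chain ε π π′
          ; maximal = λ {_} {π} i comparable →
              Follows-maximal ε π (proj₂ rootOpen) i comparable
          }

        Branch-optimal : ∀ {K L} (π : Path H K) (s : Step K L) →
                         Branch (π ◅◅ s ◅ ε) → StepOptimal s
        Branch-optimal π s f with proj₁ (Follows-open ε (π ◅◅ s ◅ ε) rootOpen f)
        ... | n , i = Strategic-step π s (strategic n) (proj₂ (∈ᵀ⇒At i))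

        -- Fairness yields some application to an ancestor of `o`, not necessarily the first.
        -- Displayed formulas also count as ancestors, so the walk along `ρ` has to stop at the
        -- first step where the tracked occurrence itself is principal.
        descend : ∀ {n K L L′} (π : Path H K) (ρ : Path K L) (s : Step L L′)
          {o : Occurrence K} → Inv n o → Ancestor ρ (principal s) o →
          Branch (π ◅◅ ρ ◅◅ s ◅ ε) →
          ∃[ M ] Σ (Path H M) λ τ → Branch τ × Prv n (flat M)
        descend π ε       s@(step o r k) i ε b = _ , _ , b , Branch-optimal π s b i k
        descend π (s₁ ◅ ρ) s i (immediate {o} {r = r} {R} {k} o′ ◅ anc) b =
          -- Here `immediateDescendant o R o′` is the tracked occurrence and `o` the principal one
          -- of this step. If they differ, `o′` is a copy that inherits the pending inference.
          continue (lowerEM em {immediateDescendant o R o′ ≡ o})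
          where
          π′ = π ◅◅ step o r k ◅ ε
          b′ : Branch (π′ ◅◅ ρ ◅◅ s ◅ ε)
          b′ = subst Branch (sym (◅◅-assoc π (step o r k ◅ ε) (ρ ◅◅ s ◅ ε))) b
          b₁ : Branch π′
          b₁ = Follows-prefix ε π′ b′
          continue : _ → _
          continue (yes eq) =
            _ , π′ , b₁ , Branch-optimal π (step o r k) b₁ (subst (Inv _) eq i) k
          continue (no neq) = descend π′ ρ s (Inv-nonprincipal o r k o′ neq i) anc b′

        -- Whatever subtree a stage has grown over an axiom, its leaves are axioms, so the node
        -- would be solved.
        notAxiom : ∀ {K} (π : Path H K) → Branch π → ¬ Valid (flat K)
        notAxiom π b v with Follows-open ε π rootOpen b
        ... | (n , i) , bad with ∈ᵀ⇒At i
        ...   | D , a = bad n (D , a , λ K ℓ → Axiom-leaf (Valid⇒Axiom v) ℓ)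

        unprovable : Fair 𝔱 → ∀ n {K} (π : Path H K) → Branch π → ¬ Prv n (flat K)
        unprovable fair zero    π b (valid v) = notAxiom π b v
        unprovable fair (suc n) π b d with Prv⇒Inv d
        ... | inj₁ v = notAxiom π b v
        ... | inj₂ (o , i@(inv eq cA _ _))
          with fair run Branch isBranch {π = π} b o (cA ∘ subst Atom eq)
        ...   | L , ρ , L′ , s , b′ , anc with descend π ρ s i anc b′
        ...     | M , τ , c , d′ = unprovable fair n τ c d′

theorem3 : ExcludedMiddle (lsuc 0ℓ) →
    (sig : Signature) → let open Calculus sig in
    (𝒢 : Hypersequent) → Provable 𝒢 →
    (𝔱 : Tactic) → Fair 𝔱 →
    Σ (Tree 𝒢) λ D → Constructible 𝔱 D × IsProof D
theorem3 em sig 𝒢 provable 𝔱 fair = result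
  where
  open Calculus sig
  open FairSearch em sig
  result : Σ (Tree 𝒢) λ D → Constructible 𝔱 D × IsProof D
  result with em {∃[ n ] IsProof (stage 𝔱 𝒢 n)}
  ... | yes (n , proof) = stage 𝔱 𝒢 n , constructible 𝔱 𝒢 n , proof
  ... | no ¬proof       =
    let n , d = Provable⇒Prv provable in
    ⊥-elim (unprovable 𝔱 𝒢 (λ n proof → ¬proof (n , proof)) fair n ε tt d)
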